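{- Let $n=2^rp$, where $p$ is an odd prime and $r\ge 2$. Let $S$ be a sequence in $\mathbb{Z}_n$ which has exactly one odd term. Then $S$ is a $U(n)$-extremal sequence for the Gao constant if and only if $S$ is $U(n)$-equivalent to a sequence having one of the following forms: $(\star)$ $\ (b_1,\ p_1b_2,\ p_1p_2b_3,\ \ldots,\ p_1\cdots p_rb_{r+1},\ \underbrace{0,\ldots,0}_{n-1\text{ times}})$, where $p_1,\ldots,p_{r+1}$ are primes with $n=p_1p_2\cdots p_{r+1}$ (in some order) and $b_1,\ldots,b_{r+1}$ are integers with $b_i$ coprime to $p_i$ for each $1\le i\le r+1$; $(\ast)$ $\ (b_1,\ p_1b_2,\ p_1p_2b_3,\ \ldots,\ p_1\cdots p_{r-1}b_r,\ \underbrace{n/2,\ldots,n/2}_{m\text{ times}},\ \underbrace{0,\ldots,0}_{n-m\text{ times}})$, where $p_1,\ldots,p_r$ are primes with $n=2p_1p_2\cdots p_r$ (in some order), $b_1,\ldots,b_r$ are integers with $b_i$ coprime to $p_i$ for each $1\le i\le r$, and $m$ is an odd integer with $1\le m\le n$; $(\ast\ast)$ $\ (a_0,\ 2a_1,\ \ldots,\ 2^{r-2}a_{r-2},\ c,\ 2^{r-1},\ \underbrace{n/2,\ldots,n/2}_{n-1\text{ times}})$, where $a_0,\ldots,a_{r-2}$ are odd integers and $c$ is an integer divisible by $2^r$.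
   Context: $\mathbb{Z}_n=\mathbb{Z}/n\mathbb{Z}$ and $U(n)$ is its group of units; integers are identified with their images in $\mathbb{Z}_n$. For even $n$, an element of $\mathbb{Z}_n$ is odd if it is the image of an odd integer; terms of a sequence are counted with multiplicity. A sequence is a finite list $(x_1,\ldots,x_l)$ of elements of $\mathbb{Z}_n$ (repetitions allowed); a subsequence is obtained by restricting to a subset of the indices. For $A\subseteq\mathbb{Z}_n$, a subsequence of $(x_1,\ldots,x_l)$ with index set $I$ is an $A$-weighted zero-sum subsequence if $I\ne\emptyset$ and there exist $a_i\in A$ ($i\in I$) with $\sum_{i\in I}a_ix_i=0$. The $A$-weighted Gao constant $E_A(n)$ is the least positive integer $k$ such that every sequence of length $k$ in $\mathbb{Z}_n$ has an $A$-weighted zero-sum subsequence of length $n$. An $A$-extremal sequence for the Gao constant is a sequence in $\mathbb{Z}_n$ of length $E_A(n)-1$ which has no $A$-weighted zero-sum subsequence of length $n$. For a subgroup $A$ of $U(n)$, two sequences $(x_1,\ldots,x_l)$ and $(y_1,\ldots,y_l)$ in $\mathbb{Z}_n$ are $A$-equivalent if there exist $c\in U(n)$, a permutation $\sigma$ of $\{1,\ldots,l\}$ and $a_1,\ldots,a_l\in A$ such that $c\,y_{\sigma(i)}=a_ix_i$ for all $1\le i\le l$. -}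

module Defs where

open import Algebra.Definitions using (Invertible)
open import Data.Bool using (if_then_else_)
open import Data.Fin using (Fin; toℕ)
open import Data.Fin.Permutation using (Permutation; _⟨$⟩ʳ_)
open import Data.Fin.Subset using (Subset; Nonempty; ∣_∣) renaming (_∈_ to _∈ₛ_)
open import Data.Integer using (ℤ; +_; 0ℤ; 1ℤ; _*_; _-_)
open import Data.Integer.Coprimality using (Coprime)
open import Data.Integer.Divisibility.Signed using (_∣_)
open import Data.Integer.Properties using (+-0-commutativeMonoid)
open import Data.List using (List; []; _∷_; _++_; length; lookup; replicate; tabulate; take)
open import Data.List.Relation.Binary.Pointwise using (Pointwise)
open import Data.List.Relation.Unary.All using (All)
open import Data.Nat using (ℕ; suc; _∸_; _^_; _≤_; _/_) renaming (_*_ to _*ℕ_)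
open import Data.Nat.ListAction using (product)
open import Data.Nat.Primality using (Prime)
open import Data.Product using (_×_; ∃; ∃!; ∃-syntax)
open import Data.Sum using (_⊎_)
import Data.Vec as Vec
open import Level using (0ℓ)
open import Relation.Binary.PropositionalEquality using (_≡_)
open import Relation.Nullary using (¬_)
open import Relation.Unary using (Pred; _∈_)

open import Algebra.Properties.CommutativeMonoid.Sum +-0-commutativeMonoid using (sum)

-- ℤ_n is the setoid of integers up to congruence modulo n, so an element of
-- ℤ_n is given by an integer representative, and a subset A of ℤ_n by any
-- predicate on ℤ whose image in ℤ_n is A.

infix 4 _≡_[mod_] _≋_[mod_]

_≡_[mod_] : ℤ → ℤ → ℕ → Set
x ≡ y [mod n ] = + n ∣ x - y

U : ℕ → Pred ℤ 0ℓ
U n = Invertible (λ x y → x ≡ y [mod n ]) 1ℤ _*_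

OddInteger : Pred ℤ 0ℓ
OddInteger x = ¬ (+ 2 ∣ x)

OddElement : ℕ → Pred ℤ 0ℓ
OddElement n x = ∃[ y ] OddInteger y × x ≡ y [mod n ]

Sequence : Set
Sequence = List ℤ

ExactlyOneOddTerm : ℕ → Pred Sequence 0ℓ
ExactlyOneOddTerm n S = ∃! _≡_ λ (i : Fin (length S)) → OddElement n (lookup S i)

sumOver : ∀ {l} → Subset l → (Fin l → ℤ) → ℤ
sumOver I f = sum λ i → if Vec.lookup I i then f i else 0ℤ

IsWeightedZeroSum : Pred ℤ 0ℓ → ℕ → (S : Sequence) → Pred (Subset (length S)) 0ℓ
IsWeightedZeroSum A n S I =
  Nonempty I ×
  ∃ λ (a : Fin (length S) → ℤ) →
    (∀ i → i ∈ₛ I → a i ∈ A) ×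
    sumOver I (λ i → a i * lookup S i) ≡ 0ℤ [mod n ]

HasWeightedZeroSum : Pred ℤ 0ℓ → (n len : ℕ) → Pred Sequence 0ℓ
HasWeightedZeroSum A n len S = ∃[ I ] IsWeightedZeroSum A n S I × ∣ I ∣ ≡ len

GaoProperty : Pred ℤ 0ℓ → (n k : ℕ) → Set
GaoProperty A n k =
  1 ≤ k × (∀ (S : Sequence) → length S ≡ k → HasWeightedZeroSum A n n S)

IsGaoConstant : Pred ℤ 0ℓ → (n k : ℕ) → Set
IsGaoConstant A n k = GaoProperty A n k × (∀ j → GaoProperty A n j → k ≤ j)

GaoExtremal : Pred ℤ 0ℓ → ℕ → Pred Sequence 0ℓ
GaoExtremal A n S =
  ∃[ k ] IsGaoConstant A n k × length S ≡ k ∸ 1 × ¬ HasWeightedZeroSum A n n S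

-- A bijection σ between the two index sets exists only when the lengths agree.
Equivalent : Pred ℤ 0ℓ → ℕ → Sequence → Sequence → Set
Equivalent A n S T =
  ∃[ c ] c ∈ U n ×
  ∃ λ (σ : Permutation (length S) (length T)) →
  ∃ λ (a : Fin (length S) → ℤ) →
    (∀ i → a i ∈ A) ×
    (∀ i → c * lookup T (σ ⟨$⟩ʳ i) ≡ a i * lookup S i [mod n ])

_≋_[mod_] : Sequence → Sequence → ℕ → Set
S ≋ T [mod n ] = Pointwise (λ x y → x ≡ y [mod n ]) S T

-- (b₁ , p₁b₂ , p₁p₂b₃ , …), with ps = p₁ , p₂ , … ; the last prime does not
-- occur in any of the products.
chain : (ps : List ℕ) → (Fin (length ps) → ℤ) → Sequence
chain ps b = tabulate λ i → + product (take (toℕ i) ps) * b i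

Form⋆ : (n r : ℕ) → Pred Sequence 0ℓ
Form⋆ n r T =
  ∃ λ (ps : List ℕ) →
  ∃ λ (b : Fin (length ps) → ℤ) →
    length ps ≡ suc r ×
    All Prime ps ×
    n ≡ product ps ×
    (∀ i → Coprime (b i) (+ lookup ps i)) ×
    T ≋ chain ps b ++ replicate (n ∸ 1) 0ℤ [mod n ]

Form∗ : (n r : ℕ) → Pred Sequence 0ℓ
Form∗ n r T =
  ∃ λ (ps : List ℕ) →
  ∃ λ (b : Fin (length ps) → ℤ) →
  ∃ λ (m : ℕ) →
    length ps ≡ r ×
    All Prime ps ×
    n ≡ 2 *ℕ product ps ×
    (∀ i → Coprime (b i) (+ lookup ps i)) ×
    OddInteger (+ m) ×
    1 ≤ m ×
    m ≤ n ×
    T ≋ chain ps b ++ replicate m (+ (n / 2)) ++ replicate (n ∸ m) 0ℤ [mod n ]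

Form∗∗ : (n r : ℕ) → Pred Sequence 0ℓ
Form∗∗ n r T =
  ∃ λ (a : Fin (r ∸ 1) → ℤ) →
  ∃ λ (c : ℤ) →
    (∀ i → OddInteger (a i)) ×
    + (2 ^ r) ∣ c ×
    T ≋ tabulate (λ i → + (2 ^ toℕ i) * a i)
          ++ c ∷ + (2 ^ (r ∸ 1)) ∷ replicate (n ∸ 1) (+ (n / 2)) [mod n ]

HasListedForm : (n r : ℕ) → Pred Sequence 0ℓ
HasListedForm n r T = Form⋆ n r T ⊎ Form∗ n r T ⊎ Form∗∗ n r T

-- Multiplying entries by units of ℤ_n changes nothing, so only the pairs (2-adic level
-- capped at r, divisibility by p) of the entries matter.  By the Chinese remainder
-- theorem a sequence has a U(n)-weighted zero sum using all its terms iff the number of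
-- its entries prime to p is not 1 and either all entries vanish modulo 2^r or the number
-- of entries of minimal 2-adic level is even.  A sequence of length n + j whose entries
-- have level at least l, where l + j = r, is then analysed by recursion on j.  If exactly
-- one entry is prime to p, it has to be deleted and only the 2-adic condition remains.
-- If level l is occupied once, that entry has to be deleted, and it becomes the next link
-- of the chain; if it is empty, one deletion is superfluous and a zero sum exists.  If it
-- is occupied at least twice, enough entries can be deleted to balance both conditions,
-- except for one configuration at l = r - 1, which is (∗∗).  Conversely, chain entries can
-- never take part in a zero sum, which disposes of the listed forms and gives the lower
-- bound for the Gao constant n + r + 1.

module Submission where

open import Defs
open import Data.Bool using (true; false; if_then_else_)
open import Data.Empty using (⊥-elim)
open import Data.Fin using (Fin; zero; suc; toℕ)
open import Data.Fin.Permutation using (Permutation; _⟨$⟩ʳ_; _⟨$⟩ˡ_; inverseˡ; ↔⇒≡)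
open import Data.Fin.Subset using (Subset; Nonempty; inside; outside) renaming (_∈_ to _∈ₛ_; ∣_∣ to ∣_∣ₛ)
open import Data.Integer using (ℤ; +_; -[1+_]; 0ℤ; 1ℤ; -1ℤ; _+_; _*_; _-_; -_)
open import Data.Integer.Coprimality using (Coprime)
import Data.Integer.DivMod as ℤ
open import Data.Integer.Divisibility.Signed
open import Data.Integer.Properties using (pos-*; pos-+; *-comm; -1*i≡-i; *-identityʳ; +-identityˡ; +-injective; +-0-commutativeMonoid)
open import Data.Integer.Tactic.RingSolver using (solve-∀)
open import Data.List using (List; []; _∷_; _++_; length; lookup; replicate; tabulate; take)
open import Data.List.Properties using (length-++; ++-assoc; length-tabulate; length-replicate; length-take; tabulate-cong)
open import Data.List.Relation.Binary.Permutation.Propositional using (_↭_; refl; prep; swap; ↭-sym; ↭-reflexive; ↭⇒↭ₛ′) renaming (trans to ↭-trans)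
open import Data.List.Relation.Binary.Permutation.Propositional.Properties using (↭-length; shifts; ++⁺; ++⁺ˡ; ++-comm) renaming (shift to ↭-shift)
import Data.List.Relation.Binary.Permutation.Setoid as PermutationSetoid
import Data.List.Relation.Binary.Permutation.Setoid.Properties as PermutationSetoidProperties
open import Data.List.Relation.Binary.Pointwise as Pointwise using ([]; _∷_)
open import Data.List.Relation.Binary.Sublist.Propositional using ([]; _∷_; _∷ʳ_) renaming (_⊆_ to _⊑_; ⊆-refl to ⊑-refl)
import Data.List.Relation.Binary.Sublist.Propositional.Properties as ⊑
open import Data.List.Relation.Unary.All as All using (All; []; _∷_)
import Data.List.Relation.Unary.All.Properties as All
open import Data.Nat as ℕ using (ℕ; zero; suc; _≤_; z≤n; s≤s; _∸_; NonZero)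
import Data.Nat.Coprimality as ℕ
import Data.Nat.DivMod as ℕ
import Data.Nat.Divisibility as ℕ
open import Data.Nat.GCD using (module Bézout)
open import Data.Nat.ListAction using (product)
open import Data.Nat.Primality using (Prime; prime⇒irreducible; prime⇒nonTrivial; prime⇒nonZero; prime[2]; ¬prime[1])
import Data.Nat.Properties as ℕ
open import Data.Nat.Tactic.RingSolver using () renaming (solve-∀ to solveℕ-∀)
open import Data.Product using (_×_; _,_; proj₁; proj₂; ∃; ∃-syntax)
open import Data.Sum using (_⊎_; inj₁; inj₂)
open import Data.Unit using (⊤; tt)
import Data.Vec as Vec
open import Data.Vec.Properties using (lookup∘tabulate; []=⇒lookup; lookup⇒[]=)
open import Function using (_∘_)
open import Function.Bundles using (_⇔_; mk⇔)
open import Level using (0ℓ)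
open import Relation.Binary.Bundles using (Setoid)
open import Relation.Binary.PropositionalEquality
open import Relation.Nullary using (¬_; yes; no)
open import Relation.Unary using (Pred; Decidable; _∈_; _⊆_)

open import Algebra.Properties.CommutativeMonoid.Sum +-0-commutativeMonoid using (sum; sum-permute; sum-cong-≗)

private variable
  A B : Pred ℤ 0ℓ
  k m q N : ℕ
  a x s t : ℤ
  xs ys zs : List ℤ
  ps : List ℕ

-- Divisibility and units

∣-resp : ∀ {d x y} → x ≡ y → d ∣ x → d ∣ y
∣-resp refl d = d

*-pres-∣ : ∀ {a b x y} → a ∣ x → b ∣ y → a * b ∣ x * y
*-pres-∣ {a} {b} (divides q refl) (divides q′ refl) = divides (q * q′) (lemma q a q′ b)
  where
  lemma : ∀ q a q′ b → q * a * (q′ * b) ≡ q * q′ * (a * b)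
  lemma = solve-∀

∣0 : ∀ {d} → d ∣ 0ℤ
∣0 {d} = divides 0ℤ refl

1∣ : ∀ {x} → 1ℤ ∣ x
1∣ {x} = divides x (sym (*-identityʳ x))

∣ℕ⇒∣ : ∀ {d e} → d ℕ.∣ e → + d ∣ + e
∣ℕ⇒∣ (ℕ.divides q refl) = divides (+ q) (pos-* q _)

unit : ∀ b → + m ∣ a * b - 1ℤ → U m a
unit {a = a} b d = b , ∣-resp (cong (_- 1ℤ) (*-comm a b)) d , d

U-1 : U m 1ℤ
U-1 = unit 1ℤ ∣0

U--1 : U m -1ℤ
U--1 = unit -1ℤ ∣0

U-* : ∀ {a b} → U m a → U m b → U m (a * b)
U-* {a = a} {b} (a′ , _ , d) (b′ , _ , e) =
  unit (a′ * b′) (∣-resp (lemma a a′ b b′) (∣m∣n⇒∣m+n (∣m⇒∣m*n (b * b′) d) e))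
  where
  lemma : ∀ a a′ b b′ → (a * a′ - 1ℤ) * (b * b′) + (b * b′ - 1ℤ) ≡ a * b * (a′ * b′) - 1ℤ
  lemma = solve-∀

U-inverse : ∀ (u : U m a) → U m (proj₁ u)
U-inverse {a = a} (_ , d , _) = unit a d

U-cancel : ∀ {d} → U m a → d ∣ + m → d ∣ a * x → d ∣ x
U-cancel {a = a} {x = x} (a′ , e , _) d∣m d∣ax =
  ∣-resp (lemma a a′ x) (∣m∣n⇒∣m-n (∣n⇒∣m*n a′ d∣ax) (∣m⇒∣m*n x (∣-trans d∣m e)))
  where
  lemma : ∀ a a′ x → a′ * (a * x) - (a′ * a - 1ℤ) * x ≡ x
  lemma = solve-∀

-- If b inverts a modulo q and b′ inverts a modulo q^k, then (ab - 1)(ab′ - 1) is divisible by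
-- q^(k+1). Expanded, it is up to sign the error of b + b′ - abb′ as an inverse of a.
U-power : ∀ k → U q a → U (q ℕ.^ k) a
U-power zero u = unit 1ℤ 1∣
U-power {q} {a} (suc k) u@(b , _ , d) with U-power {q} k u
... | b′ , _ , d′ = unit (b + b′ - a * (b * b′))
  (subst₂ _∣_ (sym (pos-* q (q ℕ.^ k))) (lemma a b b′) (∣m⇒∣-m (*-pres-∣ d d′)))
  where
  lemma : ∀ a b b′ → - ((a * b - 1ℤ) * (a * b′ - 1ℤ)) ≡ a * (b + b′ - a * (b * b′)) - 1ℤ
  lemma = solve-∀

coprime⇒U : ℕ.Coprime k m → U m (+ k)
coprime⇒U {k} {m} c with ℕ.coprime-Bézout c
... | Bézout.+- x y eq = unit (+ x) (divides (+ y) (begin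
    + k * + x - 1ℤ           ≡⟨ cong (_- 1ℤ) (trans (*-comm (+ k) (+ x)) (sym (pos-* x k))) ⟩
    + (x ℕ.* k) - 1ℤ         ≡⟨ cong (λ z → + z - 1ℤ) (sym eq) ⟩
    + (1 ℕ.+ y ℕ.* m) - 1ℤ   ≡⟨ cong (_- 1ℤ) (pos-+ 1 (y ℕ.* m)) ⟩
    1ℤ + + (y ℕ.* m) - 1ℤ    ≡⟨ cong (λ z → 1ℤ + z - 1ℤ) (pos-* y m) ⟩
    1ℤ + + y * + m - 1ℤ      ≡⟨ lemma (+ y * + m) ⟩
    + y * + m                ∎))
  where
  open ≡-Reasoning
  lemma : ∀ z → 1ℤ + z - 1ℤ ≡ z
  lemma = solve-∀
... | Bézout.-+ x y eq = unit (- + x) (divides (- + y) (begin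
    + k * - + x - 1ℤ         ≡⟨ lemma (+ k) (+ x) ⟩
    - (1ℤ + + x * + k)       ≡⟨ cong (λ z → - (1ℤ + z)) (sym (pos-* x k)) ⟩
    - (1ℤ + + (x ℕ.* k))     ≡⟨ cong -_ (sym (pos-+ 1 (x ℕ.* k))) ⟩
    - + (1 ℕ.+ x ℕ.* k)      ≡⟨ cong (λ z → - + z) eq ⟩
    - + (y ℕ.* m)            ≡⟨ cong -_ (pos-* y m) ⟩
    - (+ y * + m)            ≡⟨ lemma′ (+ y) (+ m) ⟩
    - + y * + m              ∎))
  where
  open ≡-Reasoning
  lemma : ∀ k x → k * - x - 1ℤ ≡ - (1ℤ + x * k)
  lemma = solve-∀
  lemma′ : ∀ y m → - (y * m) ≡ - y * m
  lemma′ = solve-∀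

prime∤⇒coprime : ∀ {p k} → Prime p → ¬ p ℕ.∣ k → ℕ.Coprime k p
prime∤⇒coprime pp p∤k (d∣k , d∣p) with prime⇒irreducible pp d∣p
... | inj₁ d≡1 = d≡1
... | inj₂ refl = ⊥-elim (p∤k d∣k)

prime∤⇒U : ∀ {p} → Prime p → ¬ + p ∣ a → U p a
prime∤⇒U {+ k} pp p∤a = coprime⇒U (prime∤⇒coprime pp (λ d → p∤a (∣ᵤ⇒∣ d)))
prime∤⇒U { -[1+ k ]} {p} pp p∤a =
  subst (U p) (-1*i≡-i (+ suc k)) (U-* U--1 (coprime⇒U (prime∤⇒coprime pp (λ d → p∤a (∣ᵤ⇒∣ d)))))

odd⇒∣-1 : OddInteger a → + 2 ∣ a - 1ℤ
odd⇒∣-1 {a} odd = result (a ℤ.%ℕ 2) (ℤ.n%ℕd<d a 2) (ℤ.a≡a%ℕn+[a/ℕn]*n a 2)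
  where
  lemma : ∀ h → 1ℤ + h - 1ℤ ≡ h
  lemma = solve-∀
  result : ∀ e → e ℕ.< 2 → a ≡ + e + (a ℤ./ℕ 2) * + 2 → + 2 ∣ a - 1ℤ
  result 0 _ eq = ⊥-elim (odd (divides (a ℤ./ℕ 2) (trans eq (+-identityˡ ((a ℤ./ℕ 2) * + 2)))))
  result 1 _ eq = divides (a ℤ./ℕ 2) (trans (cong (_- 1ℤ) eq) (lemma ((a ℤ./ℕ 2) * + 2)))
  result (suc (suc _)) (s≤s (s≤s ())) _

2∣1+even : + 2 ∣ a → OddInteger (1ℤ + a)
2∣1+even d d′ with ℕ.∣⇒≤ (∣⇒∣ᵤ (∣m+n∣n⇒∣m {m = 1ℤ} d′ d))
... | s≤s ()

odd⇒U2^ : ∀ k → OddInteger a → U (2 ℕ.^ k) a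
odd⇒U2^ k odd = U-power k (prime∤⇒U prime[2] odd)

U⇒odd : + 2 ∣ + m → U m ⊆ OddInteger
U⇒odd 2∣m {a} u 2∣a with ℕ.∣⇒≤ (∣⇒∣ᵤ (U-cancel {x = 1ℤ} u 2∣m (∣m⇒∣m*n 1ℤ 2∣a)))
... | s≤s ()

odd-*-∣ : ∀ {a b} → + 2 ∣ a - 1ℤ → + 2 ∣ b - 1ℤ → + 2 ∣ a * b - 1ℤ
odd-*-∣ {a} {b} d e = ∣-resp (lemma a b) (∣m∣n⇒∣m+n (∣m⇒∣m*n b d) e)
  where
  lemma : ∀ a b → (a - 1ℤ) * b + (b - 1ℤ) ≡ a * b - 1ℤ
  lemma = solve-∀

-- Weighted sums

infixr 5 _∷_

-- Every entry carries a weight and the value is an index, so that combinations of one list for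
-- different moduli can be merged entry by entry.
data Comb (A : Pred ℤ 0ℓ) : List ℤ → ℤ → Set where
  []  : Comb A [] 0ℤ
  _∷_ : a ∈ A → Comb A xs s → Comb A (x ∷ xs) (a * x + s)

Comb-map : A ⊆ B → Comb A xs s → Comb B xs s
Comb-map f []       = []
Comb-map f (u ∷ us) = f u ∷ Comb-map f us

Comb-∣ : ∀ {d} → All (d ∣_) xs → Comb A xs s → d ∣ s
Comb-∣ [] [] = ∣0
Comb-∣ (d ∷ ds) (_∷_ {a = a} u us) = ∣m∣n⇒∣m+n (∣n⇒∣m*n a d) (Comb-∣ ds us)

unweighted : ∀ xs → ∃[ s ] Comb (_≡ 1ℤ) xs s
unweighted [] = _ , []
unweighted (x ∷ xs) = _ , refl ∷ proj₂ (unweighted xs)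

U-unweighted : Comb (_≡ 1ℤ) xs s → Comb (U m) xs s
U-unweighted = Comb-map λ { refl → U-1 }

-- A relation instead of a computed count, so that matching on it delivers the divisibility proof of
-- each entry.
data Missing (m : ℕ) : ℕ → List ℤ → Set where
  []   : Missing m 0 []
  hit  : + m ∣ x → Missing m k xs → Missing m k (x ∷ xs)
  miss : ¬ + m ∣ x → Missing m k xs → Missing m (suc k) (x ∷ xs)

Missing-++ : ∀ {k l} → Missing m k xs → Missing m l ys → Missing m (k ℕ.+ l) (xs ++ ys)
Missing-++ []         N = N
Missing-++ (hit d M)  N = hit d (Missing-++ M N)
Missing-++ (miss d M) N = miss d (Missing-++ M N)

Missing-all : All (λ x → ¬ + m ∣ x) xs → Missing m (length xs) xs
Missing-all []       = []
Missing-all (d ∷ ds) = miss d (Missing-all ds)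

Missing-none : All (λ x → + m ∣ x) xs → Missing m 0 xs
Missing-none []       = []
Missing-none (d ∷ ds) = hit d (Missing-none ds)

-- The targets attainable modulo an odd prime p by unit weights on a list with
-- k entries prime to p.
Attainable : ℕ → ℕ → ℤ → Set
Attainable p 0             t = + p ∣ t
Attainable p 1             t = ¬ + p ∣ t
Attainable p (suc (suc _)) t = ⊤

-- Induction on the list: the weight of the first entry is chosen so that the target left over is
-- attainable by the rest.
Comb-attain : ∀ {p} → Prime p → p ≢ 2 → Missing p k xs → Attainable p k t →
              ∃[ s ] Comb (U p) xs s × + p ∣ s - t
Comb-attain {t = t} pp p≢2 [] p∣t = _ , [] , ∣m∣n⇒∣m-n ∣0 p∣t
Comb-attain {k} {x ∷ xs} {t} {p} pp p≢2 M′ at = step M′ at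
  where
  shift : ∀ a {k} → U p a → Missing p k xs → Attainable p k (t - a * x) →
          ∃[ s ] Comb (U p) (x ∷ xs) s × + p ∣ s - t
  shift a u M at with Comb-attain pp p≢2 M at
  ... | s , us , d = _ , u ∷ us , ∣-resp (lemma s t (a * x)) d
    where
    lemma : ∀ s t y → s - (t - y) ≡ y + s - t
    lemma = solve-∀

  2-unit : U p (+ 2)
  2-unit = prime∤⇒U pp λ d → p∤2 (∣⇒∣ᵤ d)
    where
    p∤2 : ¬ p ℕ.∣ 2
    p∤2 p∣2 with prime⇒irreducible prime[2] p∣2
    ... | inj₂ p≡2 = p≢2 p≡2
    ... | inj₁ p≡1 = ¬prime[1] (subst Prime p≡1 pp)

  step : ∀ {k} → Missing p k (x ∷ xs) → Attainable p k t → _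
  step (hit d M) at = shift 1ℤ U-1 M (go _ at)
    where
    p∣1*x = ∣n⇒∣m*n 1ℤ d
    lemma : ∀ t y → t - y + y ≡ t
    lemma = solve-∀
    go : ∀ k → Attainable p k t → Attainable p k (t - 1ℤ * x)
    go 0             p∣t = ∣m∣n⇒∣m-n p∣t p∣1*x
    go 1             p∤t e = p∤t (∣-resp (lemma t (1ℤ * x)) (∣m∣n⇒∣m+n e p∣1*x))
    go (suc (suc _)) _   = tt
  -- No later entry is prime to p, so this one has to meet the target alone, with the weight t/x.
  step (miss {k = 0} p∤x M) p∤t with prime∤⇒U pp p∤x
  ... | v@(x′ , d , _) = shift (t * x′) (U-* (prime∤⇒U pp p∤t) (U-inverse {a = x} v)) M
          (∣-resp (lemma t x x′) (∣n⇒∣m*n (- t) d))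
    where
    lemma : ∀ t x x′ → - t * (x′ * x - 1ℤ) ≡ t - t * x′ * x
    lemma = solve-∀
  -- The rest attains exactly the nonzero targets. The candidates t - x and t + x differ by 2x,
  -- which is nonzero as p is odd, so one of the weights 1 and -1 works.
  step (miss {k = 1} p∤x M) _ with + p ∣? t - 1ℤ * x
  ... | no  p∤ = shift 1ℤ U-1 M p∤
  ... | yes p∣ = shift -1ℤ U--1 M λ p∣′ →
          p∤x (U-cancel 2-unit ∣-refl (∣-resp (lemma t x) (∣m∣n⇒∣m-n p∣′ p∣)))
    where
    lemma : ∀ t x → t - -1ℤ * x - (t - 1ℤ * x) ≡ + 2 * x
    lemma = solve-∀
  step (miss {k = suc (suc _)} p∤x M) _ = shift 1ℤ U-1 M tt

Comb-zero-mod-prime : ∀ {p} → Prime p → p ≢ 2 → Missing p k xs → k ≢ 1 →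
                      ∃[ s ] Comb (U p) xs s × + p ∣ s
Comb-zero-mod-prime {k} pp p≢2 M k≢1 with Comb-attain pp p≢2 M (attainable k k≢1)
  where
  attainable : ∀ k → k ≢ 1 → Attainable _ k 0ℤ
  attainable 0             _   = ∣0
  attainable 1             k≢1 = ⊥-elim (k≢1 refl)
  attainable (suc (suc _)) _   = tt
... | s , us , d = s , us , ∣-resp (lemma s) d
  where
  lemma : ∀ s → s - 0ℤ ≡ s
  lemma = solve-∀

-- Parity, and zero sums modulo a power of two

odd-quotient : ∀ {D} w → ¬ + (2 ℕ.* D) ∣ w * + D → OddInteger w
odd-quotient {D} w ∤x (divides v refl) =
  ∤x (divides v (trans (lemma v (+ D)) (cong (v *_) (sym (pos-* 2 D)))))
  where
  lemma : ∀ v D → v * + 2 * D ≡ v * (+ 2 * D)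
  lemma = solve-∀

-- An odd multiple of D is D modulo 2D, also after multiplication by an odd weight; so each of the k
-- entries not divisible by 2D contributes D.
Comb-parity : ∀ {D} → A ⊆ OddInteger → All (+ D ∣_) xs → Missing (2 ℕ.* D) k xs → Comb A xs s →
              + (2 ℕ.* D) ∣ s - + k * + D
Comb-parity odd [] [] [] = ∣0
Comb-parity {xs = x ∷ xs} {k} {D = D} odd (_ ∷ ds) (hit d M) (_∷_ {a = a} {s = s} u us) =
  ∣-resp (lemma (a * x) s (+ k * + D)) (∣m∣n⇒∣m+n (∣n⇒∣m*n a d) (Comb-parity odd ds M us))
  where
  lemma : ∀ y s t → y + (s - t) ≡ y + s - t
  lemma = solve-∀
Comb-parity {D = D} odd (divides w refl ∷ ds) (miss {k = k} d M) (_∷_ {a = a} {s = s} u us) =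
  ∣-resp eq (∣m∣n⇒∣m+n
    (subst (_∣ (a * w - 1ℤ) * + D) (sym (pos-* 2 D))
      (*-pres-∣ (odd-*-∣ {a} {w} (odd⇒∣-1 (odd u)) (odd⇒∣-1 (odd-quotient w d))) (∣-refl {+ D})))
    (Comb-parity odd ds M us))
  where
  lemma : ∀ a w D s k → (a * w - 1ℤ) * D + (s - k * D) ≡ a * (w * D) + s - (1ℤ + k) * D
  lemma = solve-∀
  eq : (a * w - 1ℤ) * + D + (s - + k * + D) ≡ a * (w * + D) + s - + suc k * + D
  eq = trans (lemma a w (+ D) s (+ k)) (cong (λ z → a * (w * + D) + s - z * + D) (sym (pos-+ 1 k)))

-- Frees the weight of a single entry; `Comb-zero-mod-2^` uses it to correct the sum to zero.
Comb-reweight : ∀ {P : Pred ℤ 0ℓ} → Missing m (suc k) xs → All P xs → Comb (_≡ 1ℤ) xs s →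
                ∃[ x ] P x × ¬ + m ∣ x ×
                  (∀ a → Comb (λ b → b ≡ 1ℤ ⊎ b ≡ a) xs (s + (a - 1ℤ) * x))
Comb-reweight {xs = x ∷ xs} (hit d M) (_ ∷ ps) (_∷_ {s = s} refl us) with Comb-reweight M ps us
... | y , py , m∤y , us′ = y , py , m∤y , λ a →
  subst (Comb _ _) (lemma (1ℤ * x) s ((a - 1ℤ) * y)) (inj₁ refl ∷ us′ a)
  where
  lemma : ∀ x s z → x + (s + z) ≡ x + s + z
  lemma = solve-∀
Comb-reweight {xs = x ∷ xs} (miss d M) (px ∷ ps) (_∷_ {s = s} refl us) = x , px , d , λ a →
  subst (Comb _ _) (lemma a x s) (inj₂ refl ∷ Comb-map inj₁ us)
  where
  lemma : ∀ a x s → a * x + s ≡ 1ℤ * x + s + (a - 1ℤ) * x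
  lemma = solve-∀

-- By parity the unweighted sum is a multiple τ · 2D. It is cancelled by changing the weight of one
-- entry wD with w odd.
Comb-zero-mod-2^ : ∀ r D → All (+ D ∣_) xs → Missing (2 ℕ.* D) (suc k) xs → + 2 ∣ + suc k →
                   ∃[ s ] Comb (U (2 ℕ.^ r)) xs s × + (2 ℕ.^ r) ∣ s
Comb-zero-mod-2^ {xs} {k} r D ds M even with unweighted xs
... | σ , us with Comb-reweight M ds us | 2D∣σ
  where
  2D∣σ : + (2 ℕ.* D) ∣ σ
  2D∣σ = ∣-resp (lemma σ (+ suc k * + D)) (∣m∣n⇒∣m+n
    (Comb-parity (λ { refl → U⇒odd (∣-refl {+ 2}) (U-1 {2}) }) ds M us)
    (subst (_∣ + suc k * + D) (sym (pos-* 2 D)) (*-pres-∣ even (∣-refl {+ D}))))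
    where
    lemma : ∀ σ y → σ - y + y ≡ σ
    lemma = solve-∀
... | x , divides w refl , 2D∤x , us′ | divides τ refl
  with odd⇒U2^ r (odd-quotient w 2D∤x)
... | w′ , d , _ = _ , Comb-map units (us′ (1ℤ + c)) ,
      ∣-resp eq (∣m⇒∣m*n (- (τ * + (2 ℕ.* D))) d)
  where
  -- The change is even, so the new weight 1 + c stays odd; as w′ inverts w modulo 2^r, it moves the
  -- sum by -τ · 2D.
  c = - (τ * w′) * + 2
  units : ∀ {b} → b ≡ 1ℤ ⊎ b ≡ 1ℤ + c → U (2 ℕ.^ r) b
  units (inj₁ refl) = U-1
  units (inj₂ refl) = odd⇒U2^ r (2∣1+even {c} (divides (- (τ * w′)) refl))
  lemma : ∀ w w′ τ D → (w′ * w - 1ℤ) * - (τ * (+ 2 * D)) ≡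
                        τ * (+ 2 * D) + (1ℤ + - (τ * w′) * + 2 - 1ℤ) * (w * D)
  lemma = solve-∀
  eq : (w′ * w - 1ℤ) * - (τ * + (2 ℕ.* D)) ≡ τ * + (2 ℕ.* D) + (1ℤ + c - 1ℤ) * (w * + D)
  eq = subst (λ z → (w′ * w - 1ℤ) * - (τ * z) ≡ τ * z + (1ℤ + c - 1ℤ) * (w * + D))
             (sym (pos-* 2 D)) (lemma w w′ τ (+ D))

-- Chinese remaindering of weights, with S = s p and T = t q where S + T = 1.

-- Modulo m the number S vanishes and T becomes 1, so the two factors reduce to u and its inverse.
U-crt-half : ∀ {u w S T} → S + T ≡ 1ℤ → + m ∣ S → (v : U m u) → ∀ w′ →
             + m ∣ (u * T + w * S) * (proj₁ v * T + w′ * S) - 1ℤ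
U-crt-half {u = u} {w} {S} {T} S+T m∣S (u′ , _ , d) w′ = ∣-resp eq
  (∣m∣n⇒∣m+n (∣m∣n⇒∣m+n (∣m⇒∣m*n (T * T) d) (∣m⇒∣m*n (u * (w′ * T) + w * (u′ * T + w′ * S)) m∣S))
    (∣m⇒∣m*n (- (T + 1ℤ)) m∣S))
  where
  T≡ : T ≡ 1ℤ - S
  T≡ = trans (lemma S T) (cong (_- S) S+T)
    where
    lemma : ∀ S T → T ≡ S + T - S
    lemma = solve-∀
  eq : (u * u′ - 1ℤ) * (T * T) + S * (u * (w′ * T) + w * (u′ * T + w′ * S)) + S * - (T + 1ℤ) ≡
       (u * T + w * S) * (u′ * T + w′ * S) - 1ℤ
  eq rewrite T≡ = lemma u w S u′ w′
    where
    lemma : ∀ u w S u′ w′ →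
      (u * u′ - 1ℤ) * ((1ℤ - S) * (1ℤ - S)) + S * (u * (w′ * (1ℤ - S)) + w * (u′ * (1ℤ - S) + w′ * S))
        + S * - (1ℤ - S + 1ℤ) ≡
      (u * (1ℤ - S) + w * S) * (u′ * (1ℤ - S) + w′ * S) - 1ℤ
    lemma = solve-∀

-- Coprimality of q and p in the form that recombines residues: S is 0 modulo p and 1 modulo q, and
-- T the reverse.
record Split (q p : ℕ) : Set where
  field
    S T : ℤ
    S+T : S + T ≡ 1ℤ
    p∣S : + p ∣ S
    q∣T : + q ∣ T

odd⇒Split : ∀ {p} → OddInteger (+ p) → ∀ r → Split (2 ℕ.^ r) p
odd⇒Split {p} odd r with odd⇒U2^ r odd
... | b , _ , d = record
  { S = + p * b ; T = - (+ p * b - 1ℤ) ; S+T = lemma (+ p * b)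
  ; p∣S = ∣m⇒∣m*n b ∣-refl ; q∣T = ∣m⇒∣-m d }
  where
  lemma : ∀ y → y + - (y - 1ℤ) ≡ 1ℤ
  lemma = solve-∀

module _ {q p : ℕ} (sp : Split q p) where
  open Split sp

  -- In z = zS + Tz both summands are multiples of qp: q divides z and p divides S, respectively q
  -- divides T and p divides z.
  Split-∣ : ∀ {z} → + q ∣ z → + p ∣ z → + (q ℕ.* p) ∣ z
  Split-∣ {z} q∣z p∣z rewrite pos-* q p =
    ∣-resp (trans (lemma z S T) (trans (cong (z *_) S+T) (lemma′ z)))
      (∣m∣n⇒∣m+n (*-pres-∣ q∣z p∣S) (*-pres-∣ q∣T p∣z))
    where
    lemma : ∀ z S T → z * S + T * z ≡ z * (S + T)
    lemma = solve-∀
    lemma′ : ∀ z → z * 1ℤ ≡ z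
    lemma′ = solve-∀

  U-crt : ∀ {u w} → U p u → U q w → U (q ℕ.* p) (u * T + w * S)
  U-crt {u} {w} u₁@(u′ , _) w₁@(w′ , _) = unit (u′ * T + w′ * S) (Split-∣
    (∣-resp (lemma u w u′ w′ S T) (U-crt-half {w = u} (trans (lemma′ T S) S+T) q∣T w₁ u′))
    (U-crt-half {w = w} S+T p∣S u₁ w′))
    where
    lemma : ∀ u w u′ w′ S T → (w * S + u * T) * (w′ * S + u′ * T) - 1ℤ ≡
                              (u * T + w * S) * (u′ * T + w′ * S) - 1ℤ
    lemma = solve-∀
    lemma′ : ∀ T S → T + S ≡ S + T
    lemma′ = solve-∀

  Comb-crt : ∀ {s s′} → Comb (U p) xs s → Comb (U q) xs s′ → Comb (U (q ℕ.* p)) xs (s * T + s′ * S)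
  Comb-crt [] [] = []
  Comb-crt {xs = x ∷ _} (_∷_ {a = a} {s = s} u us) (_∷_ {a = b} {s = s′} w ws) =
    subst (Comb _ _) (lemma a b x s s′ S T) (U-crt u w ∷ Comb-crt us ws)
    where
    lemma : ∀ a b x s s′ S T → (a * T + b * S) * x + (s * T + s′ * S) ≡ (a * x + s) * T + (b * x + s′) * S
    lemma = solve-∀

  -- The two zero sums share their entries but not their weights, so the conditions modulo p and
  -- modulo q can be treated independently.
  Comb-crt-zero : ∃[ s ] Comb (U p) xs s × + p ∣ s → ∃[ s ] Comb (U q) xs s × + q ∣ s →
                  ∃[ s ] Comb (U (q ℕ.* p)) xs s × + (q ℕ.* p) ∣ s
  Comb-crt-zero (s , us , p∣s) (s′ , ws , q∣s′) = _ , Comb-crt us ws , Split-∣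
    (∣m∣n⇒∣m+n (∣n⇒∣m*n s q∣T) (∣m⇒∣m*n S q∣s′))
    (∣m∣n⇒∣m+n (∣m⇒∣m*n T p∣s) (∣n⇒∣m*n s′ p∣S))

-- Weighted sums of subsequences

-- An inductive substitute for index subsets with weight functions, on which sublists and
-- permutations act by recursion.
data WSum (A : Pred ℤ 0ℓ) : ℕ → ℤ → List ℤ → Set where
  []   : WSum A 0 0ℤ []
  skip : WSum A k s xs → WSum A k s (x ∷ xs)
  pick : a ∈ A → WSum A k s xs → WSum A (suc k) (a * x + s) (x ∷ xs)

ZeroSum : Pred ℤ 0ℓ → (n k : ℕ) → List ℤ → Set
ZeroSum A n k xs = ∃[ s ] WSum A k s xs × + n ∣ s

Comb⇒WSum : Comb A xs s → WSum A (length xs) s xs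
Comb⇒WSum []       = []
Comb⇒WSum (u ∷ us) = pick u (Comb⇒WSum us)

WSum-⊑ : xs ⊑ ys → WSum A k s xs → WSum A k s ys
WSum-⊑ []           w          = w
WSum-⊑ (_ ∷ʳ ι)     w          = skip (WSum-⊑ ι w)
WSum-⊑ (refl ∷ ι)   (skip w)   = skip (WSum-⊑ ι w)
WSum-⊑ (refl ∷ ι)   (pick u w) = pick u (WSum-⊑ ι w)

WSum-↭ : xs ↭ ys → WSum A k s xs → WSum A k s ys
WSum-↭ refl w = w
WSum-↭ (prep x π) (skip w) = skip (WSum-↭ π w)
WSum-↭ (prep x π) (pick u w) = pick u (WSum-↭ π w)
WSum-↭ (swap x y π) (skip (skip w)) = skip (skip (WSum-↭ π w))
WSum-↭ (swap x y π) (skip (pick u w)) = pick u (skip (WSum-↭ π w))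
WSum-↭ (swap x y π) (pick u (skip w)) = skip (pick u (WSum-↭ π w))
WSum-↭ (swap x y π) (pick {a = a} u (pick {a = b} {s = s} v w)) =
  subst (λ z → WSum _ _ z _) (lemma (b * y) (a * x) s) (pick v (pick u (WSum-↭ π w)))
  where
  lemma : ∀ y x s → y + (x + s) ≡ x + (y + s)
  lemma = solve-∀
WSum-↭ (↭-trans π ρ) w = WSum-↭ ρ (WSum-↭ π w)

ZeroSum-⊑ : xs ⊑ ys → ZeroSum A N k xs → ZeroSum A N k ys
ZeroSum-⊑ ι (s , w , d) = s , WSum-⊑ ι w , d

ZeroSum-↭ : xs ↭ ys → ZeroSum A N k xs → ZeroSum A N k ys
ZeroSum-↭ π (s , w , d) = s , WSum-↭ π w , d

WSum⇒Comb : ∀ {P : Pred ℤ 0ℓ} → All P xs → WSum A k s xs →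
            ∃[ ys ] All P ys × length ys ≡ k × Comb A ys s
WSum⇒Comb [] [] = [] , [] , refl , []
WSum⇒Comb (p ∷ ps) (skip w) = WSum⇒Comb ps w
WSum⇒Comb (p ∷ ps) (pick u w) with WSum⇒Comb ps w
... | ys , qs , refl , us = _ ∷ ys , p ∷ qs , refl , u ∷ us

WSum-≤ : WSum A k s xs → k ℕ.≤ length xs
WSum-≤ []         = z≤n
WSum-≤ (skip w)   = ℕ.m≤n⇒m≤1+n (WSum-≤ w)
WSum-≤ (pick u w) = s≤s (WSum-≤ w)

fromSubset : ∀ xs (I : Subset (length xs)) (a : Fin (length xs) → ℤ) → (∀ i → i ∈ₛ I → a i ∈ A) →
             WSum A ∣ I ∣ₛ (sumOver I (λ i → a i * lookup xs i)) xs
fromSubset [] Vec.[] a as = []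
fromSubset (x ∷ xs) (inside Vec.∷ I) a as =
  pick (as zero Vec.here) (fromSubset xs I (a ∘ suc) (λ i i∈ → as (suc i) (Vec.there i∈)))
fromSubset (x ∷ xs) (outside Vec.∷ I) a as =
  subst (λ z → WSum _ _ z _) (sym (+-identityˡ (sumOver I (λ i → a (suc i) * lookup xs i))))
    (skip (fromSubset xs I (a ∘ suc) (λ i i∈ → as (suc i) (Vec.there i∈))))

toSubset : WSum A k s xs →
           ∃ λ (I : Subset (length xs)) → ∃ λ (a : Fin (length xs) → ℤ) →
             (∀ i → i ∈ₛ I → a i ∈ A) × sumOver I (λ i → a i * lookup xs i) ≡ s × ∣ I ∣ₛ ≡ k
toSubset [] = Vec.[] , (λ ()) , (λ ()) , refl , refl
toSubset (skip w) with toSubset w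
... | I , a , as , eq , card = outside Vec.∷ I
    , (λ { zero → 0ℤ ; (suc i) → a i })
    , (λ { zero () ; (suc i) (Vec.there i∈) → as i i∈ })
    , trans (+-identityˡ _) eq , card
toSubset (pick {a = b} {x = x} u w) with toSubset w
... | I , a , as , eq , card = inside Vec.∷ I
    , (λ { zero → b ; (suc i) → a i })
    , (λ { zero _ → u ; (suc i) (Vec.there i∈) → as i i∈ })
    , cong (λ z → b * x + z) eq , cong suc card

nonempty : ∀ {l} (I : Subset l) → 1 ℕ.≤ ∣ I ∣ₛ → Nonempty I
nonempty (inside Vec.∷ I) _ = zero , Vec.here
nonempty (outside Vec.∷ I) 1≤ with nonempty I 1≤
... | i , i∈ = suc i , Vec.there i∈

HasWeightedZeroSum⇒ZeroSum : HasWeightedZeroSum A N k xs → ZeroSum A N k xs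
HasWeightedZeroSum⇒ZeroSum {xs = xs} (I , (_ , a , as , d) , refl) =
  _ , fromSubset xs I a as , ∣-resp (lemma (sumOver I (λ i → a i * lookup xs i))) d
  where
  lemma : ∀ s → s - 0ℤ ≡ s
  lemma = solve-∀

ZeroSum⇒HasWeightedZeroSum : 1 ℕ.≤ k → ZeroSum A N k xs → HasWeightedZeroSum A N k xs
ZeroSum⇒HasWeightedZeroSum {xs = xs} 1≤k (s , w , d) with toSubset w
... | I , a , as , refl , card = I , (nonempty I (subst (1 ℕ.≤_) (sym card) 1≤k) , a , as ,
  ∣m∣n⇒∣m-n {m = sumOver I (λ i → a i * lookup xs i)} {n = 0ℤ} d ∣0) , card

-- Equivalent sequences

sum-mod : ∀ {d l} (f g : Fin l → ℤ) → (∀ i → d ∣ f i - g i) → d ∣ sum f - sum g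
sum-mod {l = zero}  f g h = ∣0
sum-mod {l = suc _} f g h =
  ∣-resp (lemma (f zero) (g zero) (sum (f ∘ suc)) (sum (g ∘ suc)))
    (∣m∣n⇒∣m+n (h zero) (sum-mod (f ∘ suc) (g ∘ suc) (h ∘ suc)))
  where
  lemma : ∀ a b c d → a - b + (c - d) ≡ a + c - (b + d)
  lemma = solve-∀

-- Lets `card-image` follow from the invariance of sums under permutation.
card-sum : ∀ {l} (I : Subset l) → + ∣ I ∣ₛ ≡ sumOver I (λ _ → 1ℤ)
card-sum Vec.[] = refl
card-sum (inside Vec.∷ I) = trans (pos-+ 1 ∣ I ∣ₛ) (cong (λ z → 1ℤ + z) (card-sum I))
card-sum (outside Vec.∷ I) = trans (card-sum I) (sym (+-identityˡ _))

image : ∀ {l l′} → Permutation l l′ → Subset l → Subset l′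
image σ I = Vec.tabulate λ j → Vec.lookup I (σ ⟨$⟩ˡ j)

lookup-image : ∀ {l l′} (σ : Permutation l l′) I i → Vec.lookup (image σ I) (σ ⟨$⟩ʳ i) ≡ Vec.lookup I i
lookup-image σ I i = trans (lookup∘tabulate (λ j → Vec.lookup I (σ ⟨$⟩ˡ j)) (σ ⟨$⟩ʳ i)) (cong (Vec.lookup I) (inverseˡ σ))

sumOver-image : ∀ {l l′} (σ : Permutation l l′) I (f : Fin l′ → ℤ) →
                sumOver (image σ I) f ≡ sumOver I (f ∘ (σ ⟨$⟩ʳ_))
sumOver-image σ I f = trans (sum-permute (λ j → if Vec.lookup (image σ I) j then f j else 0ℤ) σ)
  (sum-cong-≗ λ i → cong (λ b → if b then f (σ ⟨$⟩ʳ i) else 0ℤ) (lookup-image σ I i))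

card-image : ∀ {l l′} (σ : Permutation l l′) I → ∣ image σ I ∣ₛ ≡ ∣ I ∣ₛ
card-image σ I = +-injective (trans (card-sum (image σ I))
  (trans (sumOver-image σ I (λ _ → 1ℤ)) (sym (card-sum I))))

-- From c y ≡ a x one gets α x ≡ (α a⁻¹ c) y, so the zero sum is transported with the unit weights α
-- a⁻¹ c.
HasWeightedZeroSum-Equivalent : ∀ {n S T} → Equivalent (U n) n S T → 1 ℕ.≤ k →
  HasWeightedZeroSum (U n) n k S → HasWeightedZeroSum (U n) n k T
HasWeightedZeroSum-Equivalent {n = n} {S = S} {T} (c , c∈ , σ , a , as , eqs) 1≤k (I , (_ , α , αs , d) , card) =
  image σ I , (nonempty (image σ I) (subst (1 ℕ.≤_) (sym card′) 1≤k) , β , βs , d′) , card′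
  where
  card′ = trans (card-image σ I) card
  γ : Fin (length S) → ℤ
  γ i = α i * (proj₁ (as i) * c)
  β : Fin (length T) → ℤ
  β j = γ (σ ⟨$⟩ˡ j)
  βs : ∀ j → j ∈ₛ image σ I → β j ∈ U n
  βs j j∈ = U-* (αs _ (lookup⇒[]= (σ ⟨$⟩ˡ j) I
              (trans (sym (lookup∘tabulate (λ j → Vec.lookup I (σ ⟨$⟩ˡ j)) j)) ([]=⇒lookup j∈))))
            (U-* (U-inverse {a = a (σ ⟨$⟩ˡ j)} (as (σ ⟨$⟩ˡ j))) c∈)
  lemma : ∀ α b c y a x → α * b * (c * y - a * x) + α * (b * a - 1ℤ) * x ≡ α * (b * c) * y - α * x
  lemma = solve-∀
  pointwise : ∀ b i → + n ∣ (if b then β (σ ⟨$⟩ʳ i) * lookup T (σ ⟨$⟩ʳ i) else 0ℤ)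
                         - (if b then α i * lookup S i else 0ℤ)
  pointwise false i = ∣0
  pointwise true  i = subst (λ z → + n ∣ γ z * lookup T (σ ⟨$⟩ʳ i) - α i * lookup S i) (sym (inverseˡ σ))
    (∣-resp (lemma (α i) (proj₁ (as i)) c (lookup T (σ ⟨$⟩ʳ i)) (a i) (lookup S i))
      (∣m∣n⇒∣m+n (∣n⇒∣m*n (α i * proj₁ (as i)) (eqs i))
                 (∣m⇒∣m*n (lookup S i) (∣n⇒∣m*n (α i) (proj₁ (proj₂ (as i)))))))
  sumS sumT : ℤ
  sumS = sumOver I (λ i → α i * lookup S i)
  sumT = sumOver I (λ i → β (σ ⟨$⟩ʳ i) * lookup T (σ ⟨$⟩ʳ i))
  lemma′ : ∀ t s → t - s + (s - 0ℤ) ≡ t - 0ℤ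
  lemma′ = solve-∀
  d′ = ∣-resp
    (trans (lemma′ sumT sumS) (cong (_- 0ℤ) (sym (sumOver-image σ I (λ j → β j * lookup T j)))))
    (∣m∣n⇒∣m+n (sum-mod _ _ λ i → pointwise (Vec.lookup I i) i) d)

-- Entries up to unit multiples

Associated : ℕ → ℤ → ℤ → Set
Associated n x y = ∃[ a ] a ∈ U n × y ≡ a * x [mod n ]

-- A permutation up to this relation is an equivalence of sequences with c = 1.
associated-setoid : ℕ → Setoid 0ℓ 0ℓ
associated-setoid n = record
  { Carrier = ℤ ; _≈_ = Associated n
  ; isEquivalence = record { refl = λ {x} → rfl {x} ; sym = λ {x} {y} → sm {x} {y} ; trans = λ {x} {y} {z} → tr {x} {y} {z} } }
  where
  rfl : ∀ {x} → Associated n x x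
  rfl {x} = 1ℤ , U-1 , ∣-resp (lemma x) ∣0
    where
    lemma : ∀ x → 0ℤ ≡ x - 1ℤ * x
    lemma = solve-∀
  sm : ∀ {x y} → Associated n x y → Associated n y x
  sm {x} {y} (a , u@(b , d , _) , e) = b , U-inverse {a = a} u ,
    ∣-resp (lemma a b x y) (∣m⇒∣-m (∣m∣n⇒∣m+n (∣n⇒∣m*n b e) (∣m⇒∣m*n x d)))
    where
    lemma : ∀ a b x y → - (b * (y - a * x) + (b * a - 1ℤ) * x) ≡ x - b * y
    lemma = solve-∀
  tr : ∀ {x y z} → Associated n x y → Associated n y z → Associated n x z
  tr {x} {y} {z} (a , u , d) (b , v , e) = b * a , U-* v u ,
    ∣-resp (lemma a b x y z) (∣m∣n⇒∣m+n e (∣n⇒∣m*n b d))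
    where
    lemma : ∀ a b x y z → z - b * y + b * (y - a * x) ≡ z - b * a * x
    lemma = solve-∀

module _ (n : ℕ) where
  open PermutationSetoid (associated-setoid n) using () renaming (_↭_ to _↭ₙ_; onIndices to onIndicesₙ; prep to prepₙ; ↭-prep to ↭ₙ-prep; ↭-refl to ↭ₙ-refl; ↭-trans to ↭ₙ-trans)
  open PermutationSetoidProperties (associated-setoid n) using (onIndices-lookup) renaming (++⁺ˡ to ++ₙ⁺ˡ)

  ↭⇒Equivalent : ∀ {S T} → S ↭ₙ T → Equivalent (U n) n S T
  ↭⇒Equivalent {S} {T} π = 1ℤ , U-1 , onIndicesₙ π , (λ i → proj₁ (h i)) , (λ i → proj₁ (proj₂ (h i))) ,
    λ i → ∣-resp (lemma (lookup T (onIndicesₙ π ⟨$⟩ʳ i)) (proj₁ (h i) * lookup S i)) (proj₂ (proj₂ (h i)))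
    where
    h = onIndices-lookup π
    lemma : ∀ y z → y - z ≡ 1ℤ * y - z
    lemma = solve-∀

  ↭-Equivalent : ∀ {S T} → S ↭ T → Equivalent (U n) n S T
  ↭-Equivalent π = ↭⇒Equivalent (↭⇒↭ₛ′ (Setoid.isEquivalence (associated-setoid n)) π)

  -- Serves the form (∗∗), where after reordering one entry is still only a unit multiple of
  -- 2^(r-1).
  ↭-Equivalent-replace : ∀ {S} xs c {x y ys} → S ↭ xs ++ c ∷ x ∷ ys → Associated n x y →
                         Equivalent (U n) n S (xs ++ c ∷ y ∷ ys)
  ↭-Equivalent-replace xs c π x~y = ↭⇒Equivalent
    (↭ₙ-trans (↭⇒↭ₛ′ (Setoid.isEquivalence (associated-setoid n)) π)
              (++ₙ⁺ˡ xs (↭ₙ-prep c (prepₙ x~y ↭ₙ-refl))))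

-- Counting argument

¬2∣⇒2∣suc : ∀ m → ¬ 2 ℕ.∣ m → 2 ℕ.∣ suc m
¬2∣⇒2∣suc zero          odd = ⊥-elim (odd (ℕ.divides 0 refl))
¬2∣⇒2∣suc (suc zero)    odd = ℕ.divides 1 refl
¬2∣⇒2∣suc (suc (suc m)) odd = ℕ.∣m∣n⇒∣m+n (ℕ.∣-refl {2}) (¬2∣⇒2∣suc m λ e → odd (ℕ.∣m∣n⇒∣m+n (ℕ.∣-refl {2}) e))

¬2∣suc⇒2∣ : ∀ m → ¬ 2 ℕ.∣ suc m → 2 ℕ.∣ m
¬2∣suc⇒2∣ m odd = ℕ.∣m+n∣m⇒∣n (¬2∣⇒2∣suc (suc m) odd) ℕ.∣-refl

2∣⇒¬2∣suc : ∀ {m} → 2 ℕ.∣ m → ¬ 2 ℕ.∣ suc m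
2∣⇒¬2∣suc {m} e e′ with ℕ.∣⇒≤ (ℕ.∣m+n∣m⇒∣n {2} {m} {1} (subst (2 ℕ.∣_) (suc≡+1 m) e′) e)
  where
  suc≡+1 : ∀ m → suc m ≡ m ℕ.+ 1
  suc≡+1 = solveℕ-∀
... | s≤s ()

-- The counts a, b, c, d are those of the entries of minimal 2-adic level prime to
-- p, of minimal level divisible by p, of higher level prime to p, and of higher
-- level divisible by p.
module Deletion
  (n : ℕ) (2∣n : 2 ℕ.∣ n) (4≤n : 4 ℕ.≤ n)
  (Good : ℕ → ℕ → ℕ → ℕ → Set)
  (delᵃ : ∀ {a b c d} → Good a b c d → Good (suc a) b c d)
  (delᵇ : ∀ {a b c d} → Good a b c d → Good a (suc b) c d)
  (delᶜ : ∀ {a b c d} → Good a b c d → Good a b (suc c) d)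
  (delᵈ : ∀ {a b c d} → Good a b c d → Good a b c (suc d))
  (base : ∀ {a b c d} → a ℕ.+ b ℕ.+ c ℕ.+ d ≡ n → 2 ℕ.∣ a ℕ.+ b → 1 ℕ.≤ a ℕ.+ b → a ℕ.+ c ≢ 1 → Good a b c d)
  where

  private
    dropᵇ : ∀ a b c d {m} → a ℕ.+ suc b ℕ.+ c ℕ.+ d ≡ suc m → a ℕ.+ b ℕ.+ c ℕ.+ d ≡ m
    dropᵇ a b c d eq = ℕ.suc-injective (trans (lemma a b c d) eq)
      where
      lemma : ∀ a b c d → suc (a ℕ.+ b ℕ.+ c ℕ.+ d) ≡ a ℕ.+ suc b ℕ.+ c ℕ.+ d
      lemma = solveℕ-∀
    dropᶜ : ∀ a b c d {m} → a ℕ.+ b ℕ.+ suc c ℕ.+ d ≡ suc m → a ℕ.+ b ℕ.+ c ℕ.+ d ≡ m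
    dropᶜ a b c d eq = ℕ.suc-injective (trans (lemma a b c d) eq)
      where
      lemma : ∀ a b c d → suc (a ℕ.+ b ℕ.+ c ℕ.+ d) ≡ a ℕ.+ b ℕ.+ suc c ℕ.+ d
      lemma = solveℕ-∀
    dropᵈ : ∀ a b c d {m} → a ℕ.+ b ℕ.+ c ℕ.+ suc d ≡ suc m → a ℕ.+ b ℕ.+ c ℕ.+ d ≡ m
    dropᵈ a b c d eq = ℕ.suc-injective (trans (sym (ℕ.+-suc (a ℕ.+ b ℕ.+ c) d)) eq)

  -- One deletion has to make a + b even without making a + c equal to 1. If a + b is odd, an entry
  -- of minimal level goes, preferably one divisible by p. If it is even, an entry of higher level
  -- goes; with d = 0 this is blocked only for (a, c) = (0, 2), which contradicts n being even, and
  -- for (1, 1).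
  good₁ : ∀ a b c d → a ℕ.+ b ℕ.+ c ℕ.+ d ≡ suc n → 2 ℕ.≤ a ℕ.+ b → a ℕ.+ c ≢ 1 →
          Good a b c d ⊎ (a ≡ 1 × suc b ≡ n × c ≡ 1 × d ≡ 0)
  good₁ a b c d eq 2≤ ≢1 with 2 ℕ.∣? (a ℕ.+ b)
  good₁ a b c (suc d) eq 2≤ ≢1 | yes e =
    inj₁ (delᵈ (base (dropᵈ a b c d eq) e (ℕ.≤-trans (s≤s z≤n) 2≤) ≢1))
  good₁ a b zero zero eq 2≤ ≢1 | yes e =
    ⊥-elim (2∣⇒¬2∣suc 2∣n (subst (2 ℕ.∣_) (trans (lemma (a ℕ.+ b)) eq) e))
    where
    lemma : ∀ m → m ≡ m ℕ.+ 0 ℕ.+ 0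
    lemma = solveℕ-∀
  good₁ zero b 2 zero eq 2≤ ≢1 | yes e =
    ⊥-elim (2∣⇒¬2∣suc 2∣n (subst (2 ℕ.∣_) (trans (lemma b) eq) (ℕ.∣m∣n⇒∣m+n (ℕ.∣-refl {2}) e)))
    where
    lemma : ∀ b → 2 ℕ.+ b ≡ b ℕ.+ 2 ℕ.+ 0
    lemma = solveℕ-∀
  good₁ zero b 1 zero eq 2≤ ≢1 | yes e = ⊥-elim (≢1 refl)
  good₁ zero b (suc (suc (suc c))) zero eq 2≤ ≢1 | yes e =
    inj₁ (delᶜ (base (dropᶜ 0 b (suc (suc c)) 0 eq) e (ℕ.≤-trans (s≤s z≤n) 2≤) λ ()))
  good₁ 1 b 1 zero eq 2≤ ≢1 | yes e = inj₂ (refl , ℕ.suc-injective (trans (lemma b) eq) , refl , refl)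
    where
    lemma : ∀ b → 1 ℕ.+ (1 ℕ.+ b) ≡ 1 ℕ.+ (b ℕ.+ 1 ℕ.+ 0)
    lemma = solveℕ-∀
  good₁ 1 b (suc (suc c)) zero eq 2≤ ≢1 | yes e =
    inj₁ (delᶜ (base (dropᶜ 1 b (suc c) 0 eq) e (ℕ.≤-trans (s≤s z≤n) 2≤) λ ()))
  good₁ (suc (suc a)) b (suc c) zero eq 2≤ ≢1 | yes e =
    inj₁ (delᶜ (base (dropᶜ (2 ℕ.+ a) b c 0 eq) e (ℕ.≤-trans (s≤s z≤n) 2≤) λ ()))
  good₁ a (suc b) c d eq 2≤ ≢1 | no o =
    inj₁ (delᵇ (base (dropᵇ a b c d eq) (¬2∣suc⇒2∣ (a ℕ.+ b) (subst (λ m → ¬ 2 ℕ.∣ m) (ℕ.+-suc a b) o))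
      (ℕ.≤-pred (subst (2 ℕ.≤_) (ℕ.+-suc a b) 2≤)) ≢1))
  good₁ 0 zero c d eq () ≢1 | no o
  good₁ 1 zero c d eq (s≤s ()) ≢1 | no o
  good₁ 2 zero c d eq 2≤ ≢1 | no o = ⊥-elim (o (ℕ.divides 1 refl))
  good₁ (suc (suc (suc a))) zero c d eq 2≤ ≢1 | no o =
    inj₁ (delᵃ (base (ℕ.suc-injective eq) (¬2∣suc⇒2∣ (2 ℕ.+ a ℕ.+ 0) o) (s≤s z≤n) λ ()))

  good₂ : ∀ k a b c d → a ℕ.+ b ℕ.+ c ℕ.+ d ≡ 2 ℕ.+ k ℕ.+ n → 2 ℕ.≤ a ℕ.+ b → a ℕ.+ c ≢ 1 → Good a b c d

  -- One entry above length n, the only bad counts are (1, n-1, 1, 0).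
  good : ∀ k a b c d → a ℕ.+ b ℕ.+ c ℕ.+ d ≡ suc k ℕ.+ n → 2 ℕ.≤ a ℕ.+ b → a ℕ.+ c ≢ 1 →
         ¬ (a ≡ 1 × c ≡ 1 × d ≡ 0) → Good a b c d
  good zero a b c d eq 2≤ ≢1 ≢exc with good₁ a b c d eq 2≤ ≢1
  ... | inj₁ g = g
  ... | inj₂ (a≡1 , _ , c≡1 , d≡0) = ⊥-elim (≢exc (a≡1 , c≡1 , d≡0))
  good (suc k) a b c d eq 2≤ ≢1 _ = good₂ k a b c d eq 2≤ ≢1

  private
    4≤k+n : ∀ k → 4 ℕ.≤ k ℕ.+ n
    4≤k+n k = ℕ.≤-trans 4≤n (ℕ.m≤n+m n k)

  -- Delete entries one at a time, keeping at least two of minimal level and a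
  -- number different from 1 prime to p.
  good₂ k 0 b 0 (suc d) eq 2≤ ≢1 = delᵈ (good k 0 b 0 d (dropᵈ 0 b 0 d eq) 2≤ (λ ()) λ ())
  good₂ k 0 0 0 0 () 2≤ ≢1
  good₂ k 0 (suc b) 0 0 eq 2≤ ≢1 = delᵇ (good k 0 b 0 0 eq′ 2≤b (λ ()) λ ())
    where
    eq′ = dropᵇ 0 b 0 0 eq
    2≤b : 2 ℕ.≤ b
    2≤b = subst (2 ℕ.≤_) (trans (sym eq′) (lemma b)) (s≤s (ℕ.≤-trans (s≤s z≤n) (4≤k+n k)))
      where
      lemma : ∀ b → b ℕ.+ 0 ℕ.+ 0 ≡ b
      lemma = solveℕ-∀
  good₂ k a b c (suc (suc d)) eq 2≤ ≢1 =
    delᵈ (good k a b c (suc d) (dropᵈ a b c (suc d) eq) 2≤ ≢1 λ ())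
  good₂ k 1 0 1 1 eq (s≤s ()) ≢1
  good₂ k 1 1 1 1 eq 2≤ ≢1 with 4≤k+n k
  ... | 4≤ with subst (4 ℕ.≤_) (sym (ℕ.suc-injective (ℕ.suc-injective eq))) 4≤
  ...   | s≤s (s≤s ())
  -- Reducing d to 0 could end in the exceptional counts, so b is reduced instead.
  good₂ k 1 (suc (suc b)) 1 1 eq 2≤ ≢1 =
    delᵇ (good k 1 (suc b) 1 1 (dropᵇ 1 (suc b) 1 1 eq) (s≤s (s≤s z≤n)) (λ ()) λ ())
  good₂ k 0 b (suc c) 1 eq 2≤ ≢1 =
    delᵈ (good k 0 b (suc c) 0 (dropᵈ 0 b (suc c) 0 eq) 2≤ ≢1 λ ())
  good₂ k 1 b 0 1 eq 2≤ ≢1 = ⊥-elim (≢1 refl)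
  good₂ k 1 b (suc (suc c)) 1 eq 2≤ ≢1 =
    delᵈ (good k 1 b (suc (suc c)) 0 (dropᵈ 1 b (suc (suc c)) 0 eq) 2≤ ≢1 λ ())
  good₂ k (suc (suc a)) b c 1 eq 2≤ ≢1 =
    delᵈ (good k (suc (suc a)) b c 0 (dropᵈ (suc (suc a)) b c 0 eq) 2≤ ≢1 λ ())
  -- Deleting one of the two entries prime to p would leave exactly one, and reducing b would give
  -- the exceptional counts. So both go at once; the b = n entries left are even in number. The next
  -- case removes the same pair.
  good₂ zero 1 b 1 0 eq 2≤ ≢1 = delᵃ (delᶜ (base (trans (lemma b) eq′) (subst (2 ℕ.∣_) (sym b≡n) 2∣n)
      (subst (1 ℕ.≤_) (sym b≡n) (ℕ.≤-trans (s≤s z≤n) 4≤n)) λ ()))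
    where
    eq′ : b ℕ.+ 0 ≡ n
    eq′ = ℕ.suc-injective (ℕ.suc-injective (trans (lemma b) eq))
      where
      lemma : ∀ b → 2 ℕ.+ (b ℕ.+ 0) ≡ 1 ℕ.+ (b ℕ.+ 1 ℕ.+ 0)
      lemma = solveℕ-∀
    b≡n : b ≡ n
    b≡n = trans (sym (ℕ.+-identityʳ b)) eq′
    lemma : ∀ b → b ℕ.+ 0 ℕ.+ 0 ≡ b ℕ.+ 0
    lemma = solveℕ-∀
  good₂ (suc k) 1 b 1 0 eq 2≤ ≢1 = delᵃ (delᶜ (good k 0 b 0 0 eq′
      (subst (2 ℕ.≤_) (trans (sym eq′) (lemma b)) (s≤s (ℕ.≤-trans (s≤s z≤n) (4≤k+n k)))) (λ ()) λ ()))
    where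
    eq′ : b ℕ.+ 0 ℕ.+ 0 ≡ suc k ℕ.+ n
    eq′ = ℕ.suc-injective (ℕ.suc-injective (trans (lemma′ b) eq))
      where
      lemma′ : ∀ b → 2 ℕ.+ (b ℕ.+ 0 ℕ.+ 0) ≡ 1 ℕ.+ (b ℕ.+ 1 ℕ.+ 0)
      lemma′ = solveℕ-∀
    lemma : ∀ b → b ℕ.+ 0 ℕ.+ 0 ≡ b
    lemma = solveℕ-∀
  good₂ k 0 b 1 0 eq 2≤ ≢1 = ⊥-elim (≢1 refl)
  good₂ k 0 0 (suc (suc c)) 0 eq () ≢1
  good₂ k 0 1 (suc (suc c)) 0 eq (s≤s ()) ≢1
  good₂ k 0 2 (suc (suc c)) 0 eq 2≤ ≢1 = delᶜ (good k 0 2 (suc c) 0 eq′ 2≤ (c≢0 c eq′) λ ())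
    where
    eq′ : 2 ℕ.+ suc c ℕ.+ 0 ≡ suc k ℕ.+ n
    eq′ = dropᶜ 0 2 (suc c) 0 eq
    -- With c = 0 only three entries would be left, fewer than n + 1.
    c≢0 : ∀ c → 2 ℕ.+ suc c ℕ.+ 0 ≡ suc k ℕ.+ n → suc c ≢ 1
    c≢0 zero eq refl with subst (4 ℕ.≤_) (sym (ℕ.suc-injective eq)) (4≤k+n k)
    ... | s≤s (s≤s ())
  good₂ k 0 (suc (suc (suc b))) (suc (suc c)) 0 eq 2≤ ≢1 =
    delᵇ (good k 0 (suc (suc b)) (suc (suc c)) 0 (dropᵇ 0 (suc (suc b)) (suc (suc c)) 0 eq) (s≤s (s≤s z≤n)) (λ ()) λ ())
  good₂ k 1 b 0 0 eq 2≤ ≢1 = ⊥-elim (≢1 refl)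
  good₂ k 1 0 (suc (suc c)) 0 eq (s≤s ()) ≢1
  good₂ k 1 1 (suc (suc c)) 0 eq 2≤ ≢1 = delᶜ (good k 1 1 (suc c) 0 eq′ 2≤ (λ ()) λ { (_ , c≡0 , _) → c≢0 c eq′ c≡0 })
    where
    eq′ : 2 ℕ.+ suc c ℕ.+ 0 ≡ suc k ℕ.+ n
    eq′ = dropᶜ 1 1 (suc c) 0 eq
    c≢0 : ∀ c → 2 ℕ.+ suc c ℕ.+ 0 ≡ suc k ℕ.+ n → suc c ≢ 1
    c≢0 zero eq refl with subst (4 ℕ.≤_) (sym (ℕ.suc-injective eq)) (4≤k+n k)
    ... | s≤s (s≤s ())
  good₂ k 1 (suc (suc b)) (suc (suc c)) 0 eq 2≤ ≢1 =
    delᵇ (good k 1 (suc b) (suc (suc c)) 0 (dropᵇ 1 (suc b) (suc (suc c)) 0 eq) (s≤s (s≤s z≤n)) (λ ()) λ ())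
  good₂ k (suc (suc a)) (suc b) c 0 eq 2≤ ≢1 =
    delᵇ (good k (suc (suc a)) b c 0 (dropᵇ (suc (suc a)) b c 0 eq) (s≤s (s≤s z≤n)) (λ ()) λ ())
  good₂ k (suc (suc a)) 0 (suc c) 0 eq 2≤ ≢1 =
    delᶜ (good k (suc (suc a)) 0 c 0 (dropᶜ (suc (suc a)) 0 c 0 eq) (s≤s (s≤s z≤n)) (λ ()) λ ())
  good₂ k (suc (suc a)) 0 0 0 eq 2≤ ≢1 = delᵃ (good k (suc a) 0 0 0 (ℕ.suc-injective eq)
      (subst (2 ℕ.≤_) eq′ 2≤k+n) (a≢0 a (subst (2 ℕ.≤_) eq′ 2≤k+n)) λ ())
    where
    2≤k+n = s≤s (ℕ.≤-trans (s≤s z≤n) (4≤k+n k))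
    eq′ : suc k ℕ.+ n ≡ suc a ℕ.+ 0
    eq′ = trans (sym (ℕ.suc-injective eq)) (lemma a)
      where
      lemma : ∀ a → suc a ℕ.+ 0 ℕ.+ 0 ℕ.+ 0 ≡ suc a ℕ.+ 0
      lemma = solveℕ-∀
    a≢0 : ∀ a → 2 ℕ.≤ suc a ℕ.+ 0 → suc a ℕ.+ 0 ≢ 1
    a≢0 zero (s≤s ()) refl

-- Classification

separate : ∀ {P Q : Pred ℤ 0ℓ} → Decidable Q → ∀ {xs} → All P xs →
           ∃[ ys ] ∃[ zs ] xs ↭ ys ++ zs × All (λ x → P x × ¬ Q x) ys × All (λ x → P x × Q x) zs
separate Q? [] = [] , [] , refl , [] , []
separate Q? {x ∷ xs} (p ∷ ps) with Q? x | separate Q? ps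
... | no ¬q | ys , zs , π , as , bs = x ∷ ys , zs , prep x π , (p , ¬q) ∷ as , bs
... | yes q | ys , zs , π , as , bs =
  ys , x ∷ zs , ↭-trans (prep x π) (↭-sym (↭-shift x ys zs)) , as , (p , q) ∷ bs

-- Chain m ps xs: the entries of xs are m b₁, m p₁ b₂, m p₁ p₂ b₃, … with pᵢ not dividing bᵢ.
data Chain : ℕ → List ℕ → List ℤ → Set where
  []  : ∀ {m} → Chain m [] []
  _∷_ : ∀ {m q qs x xs} → + m ∣ x × ¬ + (m ℕ.* q) ∣ x → Chain (m ℕ.* q) qs xs → Chain m (q ∷ qs) (x ∷ xs)

module Classification (R p : ℕ) (p-prime : Prime p) (p≢2 : p ≢ 2) where

  -- With r = R + 1 the number n/2 can be given without division, as `h`.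
  r n h : ℕ
  r = suc R
  n = 2 ℕ.^ r ℕ.* p
  h = 2 ℕ.^ R ℕ.* p

  p-odd : OddInteger (+ p)
  p-odd 2∣p with prime⇒irreducible p-prime (∣⇒∣ᵤ 2∣p)
  ... | inj₁ ()
  ... | inj₂ 2≡p = p≢2 (sym 2≡p)

  split : ∀ l → Split (2 ℕ.^ l) p
  split = odd⇒Split p-odd

  2∣n : 2 ℕ.∣ n
  2∣n = ℕ.∣m⇒∣m*n p (ℕ.∣m⇒∣m*n (2 ℕ.^ R) ℕ.∣-refl)

  4≤n : 4 ℕ.≤ n
  4≤n = ℕ.*-mono-≤ {2} {2 ℕ.^ r} {2} {p} (ℕ.*-mono-≤ {2} {2} {1} {2 ℕ.^ R} ℕ.≤-refl (ℕ.m^n>0 2 R))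
          (ℕ.nonTrivial⇒n>1 p {{prime⇒nonTrivial p-prime}})

  Z : List ℤ → Set
  Z = ZeroSum (U n) n n

  Comb⇒Z : ∀ {xs} → length xs ≡ n → ∃[ s ] Comb (U n) xs s × + n ∣ s → Z xs
  Comb⇒Z {xs} len (s , us , d) = s , subst (λ k → WSum (U n) k s xs) len (Comb⇒WSum us) , d

  -- All entries vanish modulo 2^r, so weights 1 serve there and only the condition modulo p is
  -- left.
  zero-sum-top : ∀ {xs k} → All (+ (2 ℕ.^ r) ∣_) xs → Missing p k xs → k ≢ 1 → length xs ≡ n → Z xs
  zero-sum-top {xs} ds M k≢1 len =
    Comb⇒Z len (Comb-crt-zero (split r) (Comb-zero-mod-prime p-prime p≢2 M k≢1)
      (_ , U-unweighted (proj₂ (unweighted xs)) , Comb-∣ ds (proj₂ (unweighted xs))))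

  zero-sum-level : ∀ {xs k k′} l → All (+ (2 ℕ.^ l) ∣_) xs → Missing (2 ℕ.^ suc l) k′ xs → 2 ℕ.∣ k′ → 1 ℕ.≤ k′ →
                   Missing p k xs → k ≢ 1 → length xs ≡ n → Z xs
  zero-sum-level {k′ = suc _} l ds M₂ even _ M k≢1 len =
    Comb⇒Z len (Comb-crt-zero (split r) (Comb-zero-mod-prime p-prime p≢2 M k≢1)
      (Comb-zero-mod-2^ r (2 ℕ.^ l) ds M₂ (∣ℕ⇒∣ even)))

  Low High : ℕ → ℤ → Set
  Low  l x = + (2 ℕ.^ l) ∣ x × ¬ + (2 ℕ.^ suc l) ∣ x
  High l x = + (2 ℕ.^ l) ∣ x × + (2 ℕ.^ suc l) ∣ x

  -- Quantifying over all lists with the given counts turns the search for a zero sum into the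
  -- counting problem of `Deletion`.
  Good : ℕ → ℕ → ℕ → ℕ → ℕ → Set
  Good l a b c d = ∀ {L₁ L₀ H₁ H₀} → length L₁ ≡ a → length L₀ ≡ b → length H₁ ≡ c → length H₀ ≡ d →
    All (λ x → ¬ + p ∣ x × Low l x) L₁ → All (λ x → + p ∣ x × Low l x) L₀ →
    All (λ x → ¬ + p ∣ x × High l x) H₁ → All (λ x → + p ∣ x × High l x) H₀ →
    Z (L₁ ++ L₀ ++ H₁ ++ H₀)

  delᵃ : ∀ l {a b c d} → Good l a b c d → Good l (suc a) b c d
  delᵃ l g {x ∷ L₁} refl eb ec ed (_ ∷ A) B C D = ZeroSum-⊑ (x ∷ʳ ⊑-refl) (g refl eb ec ed A B C D)

  delᵇ : ∀ l {a b c d} → Good l a b c d → Good l a (suc b) c d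
  delᵇ l g {L₁} {x ∷ L₀} ea refl ec ed A (_ ∷ B) C D =
    ZeroSum-⊑ (⊑.++⁺ (⊑-refl {x = L₁}) (x ∷ʳ ⊑-refl)) (g ea refl ec ed A B C D)

  delᶜ : ∀ l {a b c d} → Good l a b c d → Good l a b (suc c) d
  delᶜ l g {L₁} {L₀} {x ∷ H₁} ea eb refl ed A B (_ ∷ C) D =
    ZeroSum-⊑ (⊑.++⁺ (⊑-refl {x = L₁}) (⊑.++⁺ (⊑-refl {x = L₀}) (x ∷ʳ ⊑-refl))) (g ea eb refl ed A B C D)

  delᵈ : ∀ l {a b c d} → Good l a b c d → Good l a b c (suc d)
  delᵈ l g {L₁} {L₀} {H₁} {x ∷ H₀} ea eb ec refl A B C (_ ∷ D) =
    ZeroSum-⊑ (⊑.++⁺ (⊑-refl {x = L₁}) (⊑.++⁺ (⊑-refl {x = L₀}) (⊑.++⁺ (⊑-refl {x = H₁}) (x ∷ʳ ⊑-refl))))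
      (g ea eb ec refl A B C D)

  length-parts : ∀ (L₁ L₀ H₁ H₀ : List ℤ) →
                 length (L₁ ++ L₀ ++ H₁ ++ H₀) ≡ length L₁ ℕ.+ length L₀ ℕ.+ length H₁ ℕ.+ length H₀
  length-parts L₁ L₀ H₁ H₀
    rewrite length-++ L₁ {L₀ ++ H₁ ++ H₀} | length-++ L₀ {H₁ ++ H₀} | length-++ H₁ {H₀} =
    lemma (length L₁) (length L₀) (length H₁) (length H₀)
    where
    lemma : ∀ a b c d → a ℕ.+ (b ℕ.+ (c ℕ.+ d)) ≡ a ℕ.+ b ℕ.+ c ℕ.+ d
    lemma = solveℕ-∀

  base : ∀ l {a b c d} → a ℕ.+ b ℕ.+ c ℕ.+ d ≡ n → 2 ℕ.∣ a ℕ.+ b → 1 ℕ.≤ a ℕ.+ b → a ℕ.+ c ≢ 1 → Good l a b c d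
  base l sum≡n even 1≤ ≢1 {L₁} {L₀} {H₁} {H₀} refl refl refl refl A B C D =
    zero-sum-level {L₁ ++ L₀ ++ H₁ ++ H₀} l
      (All.++⁺ (All.map (λ z → proj₁ (proj₂ z)) A) (All.++⁺ (All.map (λ z → proj₁ (proj₂ z)) B)
        (All.++⁺ (All.map (λ z → proj₁ (proj₂ z)) C) (All.map (λ z → proj₁ (proj₂ z)) D))))
      (subst (λ k → Missing (2 ℕ.^ suc l) k (L₁ ++ L₀ ++ H₁ ++ H₀)) (cong (length L₁ ℕ.+_) (ℕ.+-identityʳ (length L₀)))
        (Missing-++ (Missing-all (All.map (λ z → proj₂ (proj₂ z)) A))
        (Missing-++ (Missing-all (All.map (λ z → proj₂ (proj₂ z)) B))
        (Missing-++ (Missing-none (All.map (λ z → proj₂ (proj₂ z)) C))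
                    (Missing-none (All.map (λ z → proj₂ (proj₂ z)) D))))))
      even 1≤
      (subst (λ k → Missing p k (L₁ ++ L₀ ++ H₁ ++ H₀)) (cong (length L₁ ℕ.+_) (ℕ.+-identityʳ (length H₁)))
        (Missing-++ (Missing-all (All.map proj₁ A)) (Missing-++ (Missing-none (All.map proj₁ B))
        (Missing-++ (Missing-all (All.map proj₁ C)) (Missing-none (All.map proj₁ D))))))
      ≢1 (trans (length-parts L₁ L₀ H₁ H₀) sum≡n)

  module Del l = Deletion n 2∣n 4≤n (Good l) (delᵃ l) (delᵇ l) (delᶜ l) (delᵈ l) (base l)

  -- Zero sums in sequences with enough surplus entries

  W : ℕ → ℤ → Set
  W l x = + p ∣ x × + (2 ℕ.^ l) ∣ x

  record Parts (l : ℕ) (M : List ℤ) : Set where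
    field
      L₁ L₀ H₁ H₀ : List ℤ
      perm : M ↭ L₁ ++ L₀ ++ H₁ ++ H₀
      ≢1   : length L₁ ℕ.+ length H₁ ≢ 1
      inL₁ : All (λ x → ¬ + p ∣ x × Low l x) L₁
      inL₀ : All (λ x → + p ∣ x × Low l x) L₀
      inH₁ : All (λ x → ¬ + p ∣ x × High l x) H₁
      inH₀ : All (λ x → + p ∣ x × High l x) H₀

  parts : ∀ l {M X Y} → M ↭ X ++ Y → length X ≢ 1 →
          All (λ x → + (2 ℕ.^ l) ∣ x × ¬ + p ∣ x) X → All (λ x → + (2 ℕ.^ l) ∣ x × + p ∣ x) Y → Parts l M
  parts l {M} {X} {Y} π ≢1 as bs = go (separate (+ (2 ℕ.^ suc l) ∣?_) as) (separate (+ (2 ℕ.^ suc l) ∣?_) bs)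
    where
    go : ∃[ ys ] ∃[ zs ] X ↭ ys ++ zs × All _ ys × All _ zs → ∃[ ys ] ∃[ zs ] Y ↭ ys ++ zs × All _ ys × All _ zs → Parts l M
    go (L₁ , H₁ , ρ , A , C) (L₀ , H₀ , σ , B , D) = record
      { L₁ = L₁ ; L₀ = L₀ ; H₁ = H₁ ; H₀ = H₀
      ; perm = ↭-trans π (↭-trans (++⁺ ρ σ) (↭-trans (↭-reflexive (++-assoc L₁ H₁ (L₀ ++ H₀))) (++⁺ˡ L₁ (shifts H₁ L₀))))
      ; ≢1 = subst (_≢ 1) (trans (↭-length ρ) (length-++ L₁)) ≢1
      ; inL₁ = All.map (λ { ((a , b) , c) → b , a , c }) A
      ; inL₀ = All.map (λ { ((a , b) , c) → b , a , c }) B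
      ; inH₁ = All.map (λ { ((a , b) , c) → b , a , c }) C
      ; inH₀ = All.map (λ { ((a , b) , c) → b , a , c }) D }

  private
    rise : ∀ l j {m} → l ℕ.+ suc j ≡ m → suc l ℕ.+ j ≡ m
    rise l j eq = trans (sym (ℕ.+-suc l j)) eq

    ↭-tail : ∀ {M : List ℤ} {x xs m} → M ↭ x ∷ xs → length M ≡ suc m → length xs ≡ m
    ↭-tail π len = ℕ.suc-injective (trans (sym (↭-length π)) len)

  -- Modulo p there is no condition. Each of the j levels from l to r - 1 costs at most one
  -- deletion, paid by the j surplus entries; a level occupied twice ends the recursion, and the
  -- exception of `Deletion.good` cannot arise since a = 0.
  upper-p : ∀ j l → l ℕ.+ j ≡ r → ∀ {M} → All (W l) M → length M ≡ j ℕ.+ n → Z M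
  upper-p zero l eq {M} ds len =
    zero-sum-top (subst (λ l → All (+ (2 ℕ.^ l) ∣_) M) (trans (sym (ℕ.+-identityʳ l)) eq) (All.map proj₂ ds))
      (Missing-none (All.map proj₁ ds)) (λ ()) len
  upper-p (suc j) l eq {M} ds len = go (separate (+ (2 ℕ.^ suc l) ∣?_) ds)
    where
    go : ∃[ ys ] ∃[ zs ] M ↭ ys ++ zs × All (λ x → W l x × ¬ + (2 ℕ.^ suc l) ∣ x) ys ×
                         All (λ x → W l x × + (2 ℕ.^ suc l) ∣ x) zs → Z M
    go ([] , [] , π , _ , _) with trans (sym len) (↭-length π)
    ... | ()
    -- Level l is empty; an arbitrary entry is dropped to keep the length in step with the level.
    go ([] , x ∷ H , π , _ , _ ∷ bs) = ZeroSum-↭ (↭-sym π) (ZeroSum-⊑ (x ∷ʳ ⊑-refl)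
      (upper-p j (suc l) (rise l j eq) (All.map (λ { ((a , _) , c) → a , c }) bs) (↭-tail π len)))
    go (x ∷ [] , H , π , _ , bs) = ZeroSum-↭ (↭-sym π) (ZeroSum-⊑ (x ∷ʳ ⊑-refl)
      (upper-p j (suc l) (rise l j eq) (All.map (λ { ((a , _) , c) → a , c }) bs) (↭-tail π len)))
    go (L@(_ ∷ _ ∷ _) , H , π , as , bs) = ZeroSum-↭ (↭-sym π)
      (Del.good l j 0 (length L) 0 (length H)
        (trans (sym (length-parts [] L [] H)) (trans (sym (↭-length π)) len))
        (s≤s (s≤s z≤n)) (λ ()) (λ { (() , _) }) {[]} {L} {[]} {H} refl refl refl refl
        [] (All.map (λ { ((a , b) , c) → a , b , c }) as) [] (All.map (λ { ((a , b) , c) → a , b , c }) bs))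

  -- The surplus is one more than in `upper-p` and pays for deleting a lone entry prime to p. At l =
  -- 0 this is the upper bound for the Gao constant.
  upper : ∀ j l → l ℕ.+ j ≡ r → ∀ {M} → All (+ (2 ℕ.^ l) ∣_) M → length M ≡ suc j ℕ.+ n → Z M
  upper j l eq {M} ds len = go (separate (+ p ∣?_) ds)
    where
    many : ∀ j → l ℕ.+ j ≡ r → length M ≡ suc j ℕ.+ n → ∀ X Y → M ↭ X ++ Y → length X ≢ 1 →
           All (λ x → + (2 ℕ.^ l) ∣ x × ¬ + p ∣ x) X → All (λ x → + (2 ℕ.^ l) ∣ x × + p ∣ x) Y → Z M
    go : ∃[ ys ] ∃[ zs ] M ↭ ys ++ zs × All (λ x → + (2 ℕ.^ l) ∣ x × ¬ + p ∣ x) ys ×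
                         All (λ x → + (2 ℕ.^ l) ∣ x × + p ∣ x) zs → Z M
    go (x ∷ [] , Y , π , _ , bs) = ZeroSum-↭ (↭-sym π) (ZeroSum-⊑ (x ∷ʳ ⊑-refl)
      (upper-p j l eq (All.map (λ { (a , b) → b , a }) bs) (↭-tail π len)))
    go ([] , Y , π , as , bs) = many j eq len [] Y π (λ ()) as bs
    go (X@(_ ∷ _ ∷ _) , Y , π , as , bs) = many j eq len X Y π (λ ()) as bs

    many zero eq len X (y ∷ Y) π ≢1 as (_ ∷ bs) = ZeroSum-↭ (↭-sym π)
      (ZeroSum-⊑ (⊑.++⁺ (⊑-refl {x = X}) (y ∷ʳ ⊑-refl))
        (zero-sum-top (subst (λ l → All (+ (2 ℕ.^ l) ∣_) (X ++ Y)) (trans (sym (ℕ.+-identityʳ l)) eq)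
            (All.++⁺ (All.map proj₁ as) (All.map proj₁ bs)))
          (Missing-++ (Missing-all (All.map proj₂ as)) (Missing-none (All.map proj₂ bs)))
          (subst (_≢ 1) (sym (ℕ.+-identityʳ (length X))) ≢1)
          (↭-tail (↭-trans π (↭-shift y X Y)) len)))
    many zero eq len [] [] π ≢1 as bs with trans (sym len) (↭-length π)
    ... | ()
    -- No entry is divisible by p, so an entry prime to p is deleted; n of them remain, and n is not
    -- 1.
    many zero eq len (x ∷ X) [] π ≢1 (_ ∷ as) bs = ZeroSum-↭ (↭-sym π)
      (ZeroSum-⊑ (x ∷ʳ ⊑-refl)
        (zero-sum-top (subst (λ l → All (+ (2 ℕ.^ l) ∣_) (X ++ [])) (trans (sym (ℕ.+-identityʳ l)) eq)
            (All.++⁺ (All.map proj₁ as) []))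
          (Missing-++ (Missing-all (All.map proj₂ as)) [])
          (λ |X|≡1 → ℕ.<⇒≢ (ℕ.≤-trans (s≤s (s≤s z≤n)) 4≤n)
            (trans (sym |X|≡1) (trans (sym (length-++ X)) (↭-tail π len))))
          (↭-tail π len)))
    many (suc j) eq len X Y π ≢1 as bs = below (parts l π ≢1 as bs)
      where
      below : Parts l M → Z M
      below record { L₁ = L₁ ; L₀ = L₀ ; H₁ = H₁ ; H₀ = H₀ ; perm = π ; ≢1 = ≢1 ; inL₁ = A ; inL₀ = B ; inH₁ = C ; inH₀ = D } =
        levels L₁ L₀ A B π ≢1
        where
        ds′ : All (+ (2 ℕ.^ suc l) ∣_) (H₁ ++ H₀)
        ds′ = All.++⁺ (All.map (λ z → proj₂ (proj₂ z)) C) (All.map (λ z → proj₂ (proj₂ z)) D)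
        levels : ∀ L₁ L₀ → All (λ x → ¬ + p ∣ x × Low l x) L₁ → All (λ x → + p ∣ x × Low l x) L₀ →
                 M ↭ L₁ ++ L₀ ++ H₁ ++ H₀ → length L₁ ℕ.+ length H₁ ≢ 1 → Z M
        deep : ∀ L₁ L₀ → All (λ x → ¬ + p ∣ x × Low l x) L₁ → All (λ x → + p ∣ x × Low l x) L₀ →
               M ↭ L₁ ++ L₀ ++ H₁ ++ H₀ → length L₁ ℕ.+ length H₁ ≢ 1 → 2 ℕ.≤ length L₁ ℕ.+ length L₀ → Z M
        -- The surplus is j + 2 here, beyond the length at which the exceptional counts occur.
        deep L₁ L₀ A B π ≢1 2≤ = ZeroSum-↭ (↭-sym π) (Del.good₂ l j _ _ _ _
          (trans (sym (length-parts L₁ L₀ H₁ H₀)) (trans (sym (↭-length π)) len))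
          2≤ ≢1 {L₁} {L₀} {H₁} {H₀} refl refl refl refl A B C D)
        none : ∀ H → All (+ (2 ℕ.^ suc l) ∣_) H → M ↭ H → Z M
        none [] _ π with trans (sym len) (↭-length π)
        ... | ()
        none (x ∷ H) (_ ∷ ds) π = ZeroSum-↭ (↭-sym π) (ZeroSum-⊑ (x ∷ʳ ⊑-refl)
          (upper j (suc l) (rise l j eq) ds (↭-tail π len)))
        levels [] [] A B π ≢1 = none (H₁ ++ H₀) ds′ π
        levels (x ∷ []) [] A B π ≢1 = ZeroSum-↭ (↭-sym π) (ZeroSum-⊑ (x ∷ʳ ⊑-refl)
          (upper j (suc l) (rise l j eq) ds′ (↭-tail π len)))
        levels [] (x ∷ []) A B π ≢1 = ZeroSum-↭ (↭-sym π) (ZeroSum-⊑ (x ∷ʳ ⊑-refl)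
          (upper j (suc l) (rise l j eq) ds′ (↭-tail π len)))
        levels L₁@(_ ∷ _ ∷ _) L₀ A B π ≢1 = deep L₁ L₀ A B π ≢1 (s≤s (s≤s z≤n))
        levels L₁@(_ ∷ []) L₀@(_ ∷ _) A B π ≢1 = deep L₁ L₀ A B π ≢1 (s≤s (s≤s z≤n))
        levels [] L₀@(_ ∷ _ ∷ _) A B π ≢1 = deep [] L₀ A B π ≢1 (s≤s (s≤s z≤n))

  -- The shape of sequences without a zero sum

  2^R∣h : + (2 ℕ.^ R) ∣ + h
  2^R∣h = ∣ℕ⇒∣ (ℕ.∣m⇒∣m*n p ℕ.∣-refl)

  double-∣ : ∀ {l b} → + 2 ∣ b → + (2 ℕ.^ suc l) ∣ b * + (2 ℕ.^ l)
  double-∣ {l} {b} d = subst (_∣ b * + (2 ℕ.^ l)) (sym (pos-* 2 (2 ℕ.^ l))) (*-pres-∣ d ∣-refl)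

  -- Both y and h are divisible by p and odd multiples of 2^(r-1), so their difference vanishes
  -- modulo p and modulo 2^r.
  low⇒half : ∀ {y} → + p ∣ y → Low R y → y ≡ + h [mod n ]
  low⇒half {y} p∣y (divides w refl , 2∤) = Split-∣ (split r)
    (∣-resp eq (double-∣ {R} (∣-resp (lemma′ w (+ p)) (∣m∣n⇒∣m-n (odd⇒∣-1 (odd-quotient w 2∤)) (odd⇒∣-1 p-odd)))))
    (∣m∣n⇒∣m-n p∣y (∣ℕ⇒∣ (ℕ.∣n⇒∣m*n (2 ℕ.^ R) ℕ.∣-refl)))
    where
    lemma′ : ∀ w p → w - 1ℤ - (p - 1ℤ) ≡ w - p
    lemma′ = solve-∀
    lemma : ∀ w p t → (w - p) * t ≡ w * t - t * p
    lemma = solve-∀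
    eq : (w - + p) * + (2 ℕ.^ R) ≡ w * + (2 ℕ.^ R) - + h
    eq = trans (lemma w (+ p) (+ (2 ℕ.^ R))) (cong (λ z → w * + (2 ℕ.^ R) - z) (sym (pos-* (2 ℕ.^ R) p)))

  zero-mod : ∀ {y} → + n ∣ y → y ≡ 0ℤ [mod n ]
  zero-mod d = ∣m∣n⇒∣m-n {n = 0ℤ} d ∣0

  -- The rest of form (⋆) after some links have been split off: m is the product of the primes used
  -- so far, and j the surplus over n still present.
  record Outcome⋆ (m j : ℕ) (M : List ℤ) : Set where
    field
      factors : List ℕ
      links Y : List ℤ
      chained : Chain m factors links
      length-factors : length factors ≡ suc j
      primes : All Prime factors
      product-factors : m ℕ.* product factors ≡ n
      perm : M ↭ links ++ Y
      zeros : All (λ y → y ≡ 0ℤ [mod n ]) Y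
      length-Y : suc (length Y) ≡ n

  -- The rest of form (∗): here the primes multiply up to n/2, after which only n/2 and 0 are
  -- possible.
  record Outcome∗ (m j : ℕ) (M : List ℤ) : Set where
    field
      factors : List ℕ
      links Y₁ Y₀ : List ℤ
      chained : Chain m factors links
      length-factors : length factors ≡ j
      primes : All Prime factors
      product-factors : m ℕ.* product factors ≡ h
      perm : M ↭ links ++ Y₁ ++ Y₀
      halves : All (λ y → y ≡ + h [mod n ]) Y₁
      zeros : All (λ y → y ≡ 0ℤ [mod n ]) Y₀
      length-Y : length Y₁ ℕ.+ length Y₀ ≡ n
      odd : ¬ 2 ℕ.∣ length Y₁

  -- The rest of form (∗∗), where all links come from the prime 2. The entry `y` is still to be
  -- scaled by a unit to 2^(r-1).
  record Outcome∗∗ (m j : ℕ) (M : List ℤ) : Set where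
    field
      j′ : ℕ
      suc-j′ : suc j′ ≡ j
      links : List ℤ
      c y : ℤ
      Y : List ℤ
      chained : Chain m (replicate j′ 2) links
      perm : M ↭ links ++ c ∷ y ∷ Y
      2^r∣c : + (2 ℕ.^ r) ∣ c
      p∤y : ¬ + p ∣ y
      low : Low R y
      halves : All (λ y → y ≡ + h [mod n ]) Y
      length-Y : suc (length Y) ≡ n

  Outcome : ℕ → ℕ → List ℤ → Set
  Outcome m j M = Outcome⋆ m j M ⊎ Outcome∗ m j M ⊎ Outcome∗∗ m j M

  extend∗ : ∀ {m q m′ j x M M′} → m ℕ.* q ≡ m′ → Prime q → + m ∣ x → ¬ + m′ ∣ x → M ↭ x ∷ M′ →
            Outcome∗ m′ j M′ → Outcome∗ m (suc j) M
  extend∗ {m} {q} {x = x} refl pq d ∤x π o = record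
    { factors = q ∷ factors ; links = x ∷ links ; Y₁ = Y₁ ; Y₀ = Y₀ ; chained = (d , ∤x) ∷ chained ; length-factors = cong suc length-factors
    ; primes = pq ∷ primes ; product-factors = trans (sym (ℕ.*-assoc m q (product factors))) product-factors
    ; perm = ↭-trans π (prep x perm) ; halves = halves ; zeros = zeros ; length-Y = length-Y ; odd = odd }
    where open Outcome∗ o

  extend : ∀ {m m′ j x M M′} → m ℕ.* 2 ≡ m′ → + m ∣ x → ¬ + m′ ∣ x → M ↭ x ∷ M′ →
           Outcome m′ j M′ → Outcome m (suc j) M
  extend {m} {x = x} refl d ∤x π (inj₁ o) = inj₁ record
    { factors = 2 ∷ factors ; links = x ∷ links ; Y = Y ; chained = (d , ∤x) ∷ chained ; length-factors = cong suc length-factors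
    ; primes = prime[2] ∷ primes ; product-factors = trans (sym (ℕ.*-assoc m 2 (product factors))) product-factors
    ; perm = ↭-trans π (prep x perm) ; zeros = zeros ; length-Y = length-Y }
    where open Outcome⋆ o
  extend eq d ∤x π (inj₂ (inj₁ o)) = inj₂ (inj₁ (extend∗ eq prime[2] d ∤x π o))
  extend {x = x} refl d ∤x π (inj₂ (inj₂ o)) = inj₂ (inj₂ record
    { j′ = suc j′ ; suc-j′ = cong suc suc-j′ ; links = x ∷ links ; c = c ; y = y ; Y = Y ; chained = (d , ∤x) ∷ chained
    ; perm = ↭-trans π (prep x perm) ; 2^r∣c = 2^r∣c ; p∤y = p∤y ; low = low ; halves = halves ; length-Y = length-Y })
    where open Outcome∗∗ o

  private
    2^-comm : ∀ l → 2 ℕ.^ l ℕ.* 2 ≡ 2 ℕ.^ suc l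
    2^-comm l = ℕ.*-comm (2 ℕ.^ l) 2

    2^p-comm : ∀ l → 2 ℕ.^ l ℕ.* p ℕ.* 2 ≡ 2 ℕ.^ suc l ℕ.* p
    2^p-comm l = trans (ℕ.*-comm (2 ℕ.^ l ℕ.* p) 2) (sym (ℕ.*-assoc 2 (2 ℕ.^ l) p))

  -- Used after the only entry prime to p has become a link, which is why m contains p and l + j is
  -- R instead of r. Every level below R must be occupied exactly once and supplies a link with the
  -- prime 2.
  classify-p : ∀ j l → l ℕ.+ j ≡ R → ∀ {M} → All (W l) M → length M ≡ j ℕ.+ n → ¬ Z M → Outcome∗ (2 ℕ.^ l ℕ.* p) j M
  classify-p j l eq {M} ds len ¬z = go (separate (+ (2 ℕ.^ suc l) ∣?_) ds)
    where
    lengths : ∀ L H → M ↭ L ++ H → length L ℕ.+ length H ≡ j ℕ.+ n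
    lengths L H π = trans (sym (length-++ L)) (trans (sym (↭-length π)) len)

    -- At level R = r - 1 the n entries left are n/2 or 0 modulo n; an even number of halves would
    -- balance, hence the number is odd.
    bottom : l ≡ R → j ≡ 0 → ∀ L H → M ↭ L ++ H → All (λ x → + p ∣ x × Low l x) L → All (λ x → + p ∣ x × High l x) H →
             Outcome∗ (2 ℕ.^ l ℕ.* p) j M
    bottom refl refl L H π as bs = record
      { factors = [] ; links = [] ; Y₁ = L ; Y₀ = H ; chained = [] ; length-factors = refl ; primes = []
      ; product-factors = ℕ.*-identityʳ h ; perm = π
      ; halves = All.map (λ { (p∣x , lx) → low⇒half p∣x lx }) as
      ; zeros = All.map (λ { (p∣x , _ , hx) → zero-mod (Split-∣ (split r) hx p∣x) }) bs
      ; length-Y = lengths L H π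
      ; odd = λ even → ¬z (ZeroSum-↭ (↭-sym π) (even-case L π as even)) }
      where
      even-case : ∀ L → M ↭ L ++ H → All (λ x → + p ∣ x × Low R x) L → 2 ℕ.∣ length L → Z (L ++ H)
      even-case [] π _ _ = zero-sum-top (All.map (λ z → proj₂ (proj₂ z)) bs) (Missing-none (All.map proj₁ bs)) (λ ())
        (lengths [] H π)
      even-case L@(_ ∷ _) π as even =
        base R {0} {length L} {0} {length H} (trans (cong (ℕ._+ length H) (ℕ.+-identityʳ (length L))) (lengths L H π))
          even (s≤s z≤n) (λ ()) {[]} {L} {[]} {H} refl refl refl refl [] as [] bs

    deeper : ∀ j′ → j ≡ suc j′ → ∀ L H → M ↭ L ++ H → All (λ x → + p ∣ x × Low l x) L → All (λ x → + p ∣ x × High l x) H →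
             Outcome∗ (2 ℕ.^ l ℕ.* p) j M
    -- An empty level leaves as many surplus entries as there are levels from l + 1 to r - 1, so
    -- `upper-p` finds a zero sum.
    deeper j′ refl [] H π as bs = ⊥-elim (¬z (ZeroSum-↭ (↭-sym π)
      (upper-p (suc j′) (suc l) (cong suc eq) (All.map (λ { (a , _ , c) → a , c }) bs) (lengths [] H π))))
    deeper j′ refl (x ∷ []) H π ((p∣x , lx , hx) ∷ []) bs = extend∗ (2^p-comm l) prime[2] (Split-∣ (split l) lx p∣x)
      (λ d → hx (∣-trans (∣ℕ⇒∣ (ℕ.∣m⇒∣m*n p ℕ.∣-refl)) d)) π
      (classify-p j′ (suc l) (rise l j′ eq) (All.map (λ { (a , _ , c) → a , c }) bs) (ℕ.suc-injective (lengths (x ∷ []) H π))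
        λ z → ¬z (ZeroSum-↭ (↭-sym π) (ZeroSum-⊑ (x ∷ʳ ⊑-refl) z)))
    deeper j′ refl L@(_ ∷ _ ∷ _) H π as bs = ⊥-elim (¬z (ZeroSum-↭ (↭-sym π)
      (Del.good l j′ 0 (length L) 0 (length H)
        (trans (cong (ℕ._+ length H) (ℕ.+-identityʳ (length L))) (lengths L H π))
        (s≤s (s≤s z≤n)) (λ ()) (λ { (() , _) }) {[]} {L} {[]} {H} refl refl refl refl [] as [] bs)))

    by-level : ∀ j′ → j ≡ j′ → ∀ L H → M ↭ L ++ H → All (λ x → + p ∣ x × Low l x) L → All (λ x → + p ∣ x × High l x) H →
               Outcome∗ (2 ℕ.^ l ℕ.* p) j M
    by-level zero j≡0 = bottom (trans (sym (ℕ.+-identityʳ l)) (trans (cong (l ℕ.+_) (sym j≡0)) eq)) j≡0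
    by-level (suc j′) j≡ = deeper j′ j≡

    go : ∃[ ys ] ∃[ zs ] M ↭ ys ++ zs × All (λ x → W l x × ¬ + (2 ℕ.^ suc l) ∣ x) ys ×
                         All (λ x → W l x × + (2 ℕ.^ suc l) ∣ x) zs → Outcome∗ (2 ℕ.^ l ℕ.* p) j M
    go (L , H , π , as , bs) = by-level j refl L H π
      (All.map (λ { ((a , b) , c) → a , b , c }) as) (All.map (λ { ((a , b) , c) → a , b , c }) bs)

  -- The length is one below that of `upper`, so no deletion can be wasted; each way of using all of
  -- them up leads to one of the three outcomes.
  classify : ∀ j l → l ℕ.+ j ≡ r → ∀ {M} → All (+ (2 ℕ.^ l) ∣_) M → length M ≡ j ℕ.+ n → ¬ Z M → Outcome (2 ℕ.^ l) j M
  classify j l eq {M} ds len ¬z = go (separate (+ p ∣?_) ds)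
    where
    one : ∀ j → l ℕ.+ j ≡ r → length M ≡ j ℕ.+ n → ∀ x Y → M ↭ x ∷ Y → + (2 ℕ.^ l) ∣ x → ¬ + p ∣ x → All (W l) Y →
          Outcome (2 ℕ.^ l) j M
    -- All levels are used up: p closes the chain, and the other n - 1 entries are divisible by 2^r
    -- and by p.
    one zero eq len x Y π 2^∣x p∤x bs = inj₁ record
      { factors = p ∷ [] ; links = x ∷ [] ; Y = Y ; chained = (2^∣x , λ d → p∤x (∣-trans (∣ℕ⇒∣ (ℕ.∣n⇒∣m*n (2 ℕ.^ l) ℕ.∣-refl)) d)) ∷ []
      ; length-factors = refl ; primes = p-prime ∷ []
      ; product-factors = trans (cong (2 ℕ.^ l ℕ.*_) (ℕ.*-identityʳ p)) (cong (λ l → 2 ℕ.^ l ℕ.* p) l≡r)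
      ; perm = π
      ; zeros = All.map (λ { (p∣x , lx) → zero-mod (Split-∣ (split r) (subst (λ l → + (2 ℕ.^ l) ∣ _) l≡r lx) p∣x) }) bs
      ; length-Y = trans (sym (↭-length π)) len }
      where
      l≡r : l ≡ r
      l≡r = trans (sym (ℕ.+-identityʳ l)) eq
    one (suc j) eq len x Y π 2^∣x p∤x bs = inj₂ (inj₁ (extend∗ refl p-prime 2^∣x
      (λ d → p∤x (∣-trans (∣ℕ⇒∣ (ℕ.∣n⇒∣m*n (2 ℕ.^ l) ℕ.∣-refl)) d)) π
      (classify-p j l (ℕ.suc-injective (rise l j eq)) bs (↭-tail π len)
        λ z → ¬z (ZeroSum-↭ (↭-sym π) (ZeroSum-⊑ (x ∷ʳ ⊑-refl) z)))))

    many : ∀ j → l ℕ.+ j ≡ r → length M ≡ j ℕ.+ n → ∀ X Y → M ↭ X ++ Y → length X ≢ 1 →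
           All (λ x → + (2 ℕ.^ l) ∣ x × ¬ + p ∣ x) X → All (λ x → + (2 ℕ.^ l) ∣ x × + p ∣ x) Y → Outcome (2 ℕ.^ l) j M
    -- Everything vanishes modulo 2^r and nothing has to be deleted, so the n entries together would
    -- form a zero sum.
    many zero eq len X Y π ≢1 as bs = ⊥-elim (¬z (ZeroSum-↭ (↭-sym π)
      (zero-sum-top (subst (λ l → All (+ (2 ℕ.^ l) ∣_) (X ++ Y)) (trans (sym (ℕ.+-identityʳ l)) eq)
          (All.++⁺ (All.map proj₁ as) (All.map proj₁ bs)))
        (Missing-++ (Missing-all (All.map proj₂ as)) (Missing-none (All.map proj₂ bs)))
        (subst (_≢ 1) (sym (ℕ.+-identityʳ (length X))) ≢1)
        (trans (sym (↭-length π)) len))))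
    many (suc j) eq len X Y π ≢1 as bs = below (parts l π ≢1 as bs)
      where
      below : Parts l M → Outcome (2 ℕ.^ l) (suc j) M
      below record { L₁ = L₁ ; L₀ = L₀ ; H₁ = H₁ ; H₀ = H₀ ; perm = π ; ≢1 = ≢1 ; inL₁ = A ; inL₀ = B ; inH₁ = C ; inH₀ = D } =
        levels L₁ L₀ A B π ≢1
        where
        ds′ : All (+ (2 ℕ.^ suc l) ∣_) (H₁ ++ H₀)
        ds′ = All.++⁺ (All.map (λ z → proj₂ (proj₂ z)) C) (All.map (λ z → proj₂ (proj₂ z)) D)

        single : ∀ x → Low l x → M ↭ x ∷ H₁ ++ H₀ → Outcome (2 ℕ.^ l) (suc j) M
        single x (lx , hx) π = extend (2^-comm l) lx hx π
          (classify j (suc l) (rise l j eq) ds′ (↭-tail π len)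
            λ z → ¬z (ZeroSum-↭ (↭-sym π) (ZeroSum-⊑ (x ∷ʳ ⊑-refl) z)))

        -- The exception of `good₁` at level r - 1: the higher entry is divisible by 2^r and becomes
        -- c, the n - 1 entries divisible by p are n/2, and the remaining one is y.
        exceptional : j ≡ 0 → ∀ {L₁ L₀ H₁ H₀} → length L₁ ≡ 1 → suc (length L₀) ≡ n → length H₁ ≡ 1 → length H₀ ≡ 0 →
          All (λ x → ¬ + p ∣ x × Low l x) L₁ → All (λ x → + p ∣ x × Low l x) L₀ → All (λ x → ¬ + p ∣ x × High l x) H₁ →
          M ↭ L₁ ++ L₀ ++ H₁ ++ H₀ → Outcome (2 ℕ.^ l) (suc j) M
        exceptional refl {y ∷ []} {L₀} {c ∷ []} {[]} refl len refl refl ((p∤y , ly) ∷ []) B ((_ , _ , hc) ∷ []) π = inj₂ (inj₂ record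
          { j′ = 0 ; suc-j′ = refl ; links = [] ; c = c ; y = y ; Y = L₀ ; chained = []
          ; perm = ↭-trans π (↭-trans (prep y (++-comm L₀ (c ∷ []))) (swap y c refl))
          ; 2^r∣c = subst (λ l → + (2 ℕ.^ suc l) ∣ c) l≡R hc ; p∤y = p∤y ; low = subst (λ l → Low l y) l≡R ly
          ; halves = All.map (λ { (p∣x , lx) → low⇒half p∣x (subst (λ l → Low l _) l≡R lx) }) B
          ; length-Y = len })
          where
          l≡R : l ≡ R
          l≡R = trans (sym (ℕ.+-identityʳ l)) (ℕ.suc-injective (rise l 0 eq))

        deep : ∀ j′ → j ≡ j′ → ∀ L₁ L₀ → All (λ x → ¬ + p ∣ x × Low l x) L₁ → All (λ x → + p ∣ x × Low l x) L₀ →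
               M ↭ L₁ ++ L₀ ++ H₁ ++ H₀ → length L₁ ℕ.+ length H₁ ≢ 1 → 2 ℕ.≤ length L₁ ℕ.+ length L₀ →
               Outcome (2 ℕ.^ l) (suc j) M
        deep zero refl L₁ L₀ A B π ≢1 2≤ = result (Del.good₁ l (length L₁) (length L₀) (length H₁) (length H₀)
          (trans (sym (length-parts L₁ L₀ H₁ H₀)) (trans (sym (↭-length π)) len)) 2≤ ≢1)
          where
          result : Good l (length L₁) (length L₀) (length H₁) (length H₀) ⊎
                   (length L₁ ≡ 1 × suc (length L₀) ≡ n × length H₁ ≡ 1 × length H₀ ≡ 0) → _
          result (inj₁ g) = ⊥-elim (¬z (ZeroSum-↭ (↭-sym π) (g {L₁} {L₀} {H₁} {H₀} refl refl refl refl A B C D)))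
          result (inj₂ (a≡1 , b≡ , c≡1 , d≡0)) = exceptional refl {L₁} {L₀} {H₁} {H₀} a≡1 b≡ c≡1 d≡0 A B C π
        deep (suc k) refl L₁ L₀ A B π ≢1 2≤ = ⊥-elim (¬z (ZeroSum-↭ (↭-sym π) (Del.good₂ l k _ _ _ _
          (trans (sym (length-parts L₁ L₀ H₁ H₀)) (trans (sym (↭-length π)) len))
          2≤ ≢1 {L₁} {L₀} {H₁} {H₀} refl refl refl refl A B C D)))

        levels : ∀ L₁ L₀ → All (λ x → ¬ + p ∣ x × Low l x) L₁ → All (λ x → + p ∣ x × Low l x) L₀ →
                 M ↭ L₁ ++ L₀ ++ H₁ ++ H₀ → length L₁ ℕ.+ length H₁ ≢ 1 → Outcome (2 ℕ.^ l) (suc j) M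
        -- With level l empty, the surplus j + 1 suffices for `upper` from level l + 1.
        levels [] [] A B π ≢1 = ⊥-elim (¬z (ZeroSum-↭ (↭-sym π)
          (upper j (suc l) (rise l j eq) ds′ (trans (sym (↭-length π)) len))))
        levels (x ∷ []) [] ((_ , lx) ∷ []) B π ≢1 = single x lx π
        levels [] (x ∷ []) A ((_ , lx) ∷ []) π ≢1 = single x lx π
        levels L₁@(_ ∷ _ ∷ _) L₀ A B π ≢1 = deep j refl L₁ L₀ A B π ≢1 (s≤s (s≤s z≤n))
        levels L₁@(_ ∷ []) L₀@(_ ∷ _) A B π ≢1 = deep j refl L₁ L₀ A B π ≢1 (s≤s (s≤s z≤n))
        levels [] L₀@(_ ∷ _ ∷ _) A B π ≢1 = deep j refl [] L₀ A B π ≢1 (s≤s (s≤s z≤n))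

    go : ∃[ ys ] ∃[ zs ] M ↭ ys ++ zs × All (λ x → + (2 ℕ.^ l) ∣ x × ¬ + p ∣ x) ys ×
                         All (λ x → + (2 ℕ.^ l) ∣ x × + p ∣ x) zs → Outcome (2 ℕ.^ l) j M
    go (x ∷ [] , Y , π , (d , p∤x) ∷ [] , bs) = one j eq len x Y π d p∤x (All.map (λ { (a , b) → b , a }) bs)
    go ([] , Y , π , as , bs) = many j eq len [] Y π (λ ()) as bs
    go (X@(_ ∷ _ ∷ _) , Y , π , as , bs) = many j eq len X Y π (λ ()) as bs

-- The listed forms

WSum-∣ : ∀ {d} → All (d ∣_) xs → WSum A k s xs → d ∣ s
WSum-∣ [] [] = ∣0
WSum-∣ (_ ∷ ds) (skip w) = WSum-∣ ds w
WSum-∣ (d ∷ ds) (pick {a = a} _ w) = ∣m∣n⇒∣m+n (∣n⇒∣m*n a d) (WSum-∣ ds w)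

WSum-full : length xs ≡ k → WSum A k s xs → Comb A xs s
WSum-full _ [] = []
WSum-full len (skip w) = ⊥-elim (ℕ.<-irrefl refl (subst (_≤ _) (sym len) (WSum-≤ w)))
WSum-full len (pick u w) = u ∷ WSum-full (ℕ.suc-injective len) w

WSum-≋ : xs ≋ ys [mod N ] → WSum A k s xs → ∃[ s′ ] WSum A k s′ ys × + N ∣ s′ - s
WSum-≋ [] [] = _ , [] , ∣0
WSum-≋ (_ ∷ es) (skip w) with WSum-≋ es w
... | s′ , w′ , d = s′ , skip w′ , d
WSum-≋ (_∷_ {x} {y} e es) (pick {a = a} {s = s} u w) with WSum-≋ es w
... | s′ , w′ , d = _ , pick u w′ , ∣-resp (lemma a x y s s′) (∣m∣n⇒∣m+n (∣n⇒∣m*n (- a) e) d)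
  where
  lemma : ∀ a x y s s′ → - a * (x - y) + (s′ - s) ≡ a * y + s′ - (a * x + s)
  lemma = solve-∀

ZeroSum-≋ : xs ≋ ys [mod N ] → ZeroSum A N k xs → ZeroSum A N k ys
ZeroSum-≋ es (s , w , d) with WSum-≋ es w
... | s′ , w′ , e = s′ , w′ , ∣-resp (lemma s s′) (∣m∣n⇒∣m+n e d)
  where
  lemma : ∀ s s′ → s′ - s + s ≡ s′
  lemma = solve-∀

Chain-∣ : Chain m ps xs → All (+ m ∣_) xs
Chain-∣ [] = []
Chain-∣ {m} (_∷_ {q = q} (d , _) ch) = d ∷ All.map (∣-trans (∣ℕ⇒∣ (ℕ.∣m⇒∣m*n q ℕ.∣-refl))) (Chain-∣ ch)

-- The first chain entry is the only one not divisible by m p₁, so it cannot occur in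
-- a zero sum; hence by induction no chain entry does.
Chain-skip : ∀ {M} → m ℕ.* product ps ≡ M → Chain m ps xs → + M ∣ + N → All (+ M ∣_) zs →
             WSum (U N) k s (xs ++ zs) → + M ∣ s → WSum (U N) k s zs
Chain-skip eq [] M∣n ds w d = w
Chain-skip {m} {q ∷ ps} eq (_ ∷ ch) M∣n ds (skip w) d =
  Chain-skip (trans (ℕ.*-assoc m q (product ps)) eq) ch M∣n ds w d
Chain-skip {m} {q ∷ ps} {xs = x ∷ xs} {M = M} eq ((_ , ∤x) ∷ ch) M∣n ds (pick {a = a} u w) d =
  ⊥-elim (∤x (U-cancel u (∣-trans mq∣M M∣n)
    (∣m+n∣n⇒∣m {m = a * x} (∣-trans mq∣M d) (WSum-∣ (All.++⁺ (Chain-∣ ch) (All.map (∣-trans mq∣M) ds)) w))))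
  where
  mq∣M : + (m ℕ.* q) ∣ + M
  mq∣M = ∣ℕ⇒∣ (ℕ.divides (product ps) (trans (sym eq)
    (trans (sym (ℕ.*-assoc m q (product ps))) (ℕ.*-comm (m ℕ.* q) (product ps)))))

-- The chain multiplied by m, a family closed under taking tails, as induction requires.
scaledChain : ℕ → (ps : List ℕ) → (Fin (length ps) → ℤ) → List ℤ
scaledChain m ps b = tabulate λ i → + (m ℕ.* product (take (toℕ i) ps)) * b i

scaledChain-1 : ∀ ps b → scaledChain 1 ps b ≡ chain ps b
scaledChain-1 ps b = tabulate-cong λ i → cong (λ z → + z * b i) (ℕ.*-identityˡ (product (take (toℕ i) ps)))

scaledChain-∷ : ∀ m q ps b → scaledChain m (q ∷ ps) b ≡ + m * b zero ∷ scaledChain (m ℕ.* q) ps (b ∘ suc)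
scaledChain-∷ m q ps b = cong₂ _∷_ (cong (λ z → + z * b zero) (ℕ.*-identityʳ m))
  (tabulate-cong λ i → cong (λ z → + z * b (suc i)) (sym (ℕ.*-assoc m q (product (take (toℕ i) ps)))))

∣*-cancel : ∀ m .{{_ : NonZero m}} q b → + (m ℕ.* q) ∣ + m * b → + q ∣ b
∣*-cancel (suc m) q b d = *-cancelˡ-∣ (+ suc m) (subst (_∣ + suc m * b) (pos-* (suc m) q) d)

scaledChain-Chain : ∀ m .{{_ : NonZero m}} ps b → All Prime ps → (∀ i → Coprime (b i) (+ lookup ps i)) →
                    Chain m ps (scaledChain m ps b)
scaledChain-Chain m [] b _ _ = []
scaledChain-Chain m (q ∷ ps) b (pq ∷ pqs) cop =
  subst (Chain m (q ∷ ps)) (sym (scaledChain-∷ m q ps b))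
    ((∣m⇒∣m*n (b zero) ∣-refl , λ d → ¬prime[1] (subst Prime (cop zero (∣⇒∣ᵤ (∣*-cancel m q (b zero) d) , ℕ.∣-refl)) pq))
     ∷ scaledChain-Chain (m ℕ.* q) {{ℕ.m*n≢0 m q {{it}} {{prime⇒nonZero pq}}}} ps (b ∘ suc) pqs (cop ∘ suc))
  where
  it : NonZero m
  it = ℕ.≢-nonZero (ℕ.≢-nonZero⁻¹ m)

Chain-scaledChain : All Prime ps → Chain m ps xs →
                    ∃ λ (b : Fin (length ps) → ℤ) → (∀ i → Coprime (b i) (+ lookup ps i)) × xs ≡ scaledChain m ps b
Chain-scaledChain [] [] = (λ ()) , (λ ()) , refl
Chain-scaledChain {q ∷ ps} {m} (pq ∷ pqs) ((divides b₀ refl , ∤x) ∷ ch) with Chain-scaledChain pqs ch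
... | b , cop , eq = b′
  , (λ { zero → prime∤⇒coprime pq (λ d → ∤x (mq∣ (∣ᵤ⇒∣ d))) ; (suc i) → cop i })
  , sym (trans (scaledChain-∷ m q ps b′) (cong₂ _∷_ (*-comm (+ m) b₀) (sym eq)))
  where
  b′ : Fin (suc (length ps)) → ℤ
  b′ zero    = b₀
  b′ (suc i) = b i
  mq∣ : + q ∣ b₀ → + (m ℕ.* q) ∣ b₀ * + m
  mq∣ d = subst₂ _∣_ (trans (sym (pos-* q m)) (cong +_ (ℕ.*-comm q m))) refl (*-pres-∣ d (∣-refl {+ m}))

-- The analogue of `scaledChain` when every prime is 2, in the closed form of (∗∗).
powers : ℕ → ∀ k → (Fin k → ℤ) → List ℤ
powers m k a = tabulate λ i → + (m ℕ.* 2 ℕ.^ toℕ i) * a i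

powers-1 : ∀ k a → powers 1 k a ≡ tabulate λ i → + (2 ℕ.^ toℕ i) * a i
powers-1 k a = tabulate-cong λ i → cong (λ z → + z * a i) (ℕ.*-identityˡ (2 ℕ.^ toℕ i))

powers-suc : ∀ m k a → powers m (suc k) a ≡ + m * a zero ∷ powers (m ℕ.* 2) k (a ∘ suc)
powers-suc m k a = cong₂ _∷_ (cong (λ z → + z * a zero) (ℕ.*-identityʳ m))
  (tabulate-cong λ i → cong (λ z → + z * a (suc i)) (sym (ℕ.*-assoc m 2 (2 ℕ.^ toℕ i))))

powers-Chain : ∀ m .{{_ : NonZero m}} k a → (∀ i → OddInteger (a i)) → Chain m (replicate k 2) (powers m k a)
powers-Chain m zero a odd = []
powers-Chain m (suc k) a odd = subst (Chain m (2 ∷ replicate k 2)) (sym (powers-suc m k a))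
  ((∣m⇒∣m*n (a zero) ∣-refl , λ d → odd zero (∣*-cancel m 2 (a zero) d))
   ∷ powers-Chain (m ℕ.* 2) {{ℕ.m*n≢0 m 2}} k (a ∘ suc) (odd ∘ suc))

Chain-powers : ∀ k → Chain m (replicate k 2) xs →
               ∃ λ (a : Fin k → ℤ) → (∀ i → OddInteger (a i)) × xs ≡ powers m k a
Chain-powers zero [] = (λ ()) , (λ ()) , refl
Chain-powers {m} (suc k) ((divides a₀ refl , ∤x) ∷ ch) with Chain-powers k ch
... | a , odd , eq = a′
  , (λ { zero → λ d → ∤x (m2∣ d) ; (suc i) → odd i })
  , sym (trans (powers-suc m k a′) (cong₂ _∷_ (*-comm (+ m) a₀) (sym eq)))
  where
  a′ : Fin (suc k) → ℤ
  a′ zero    = a₀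
  a′ (suc i) = a i
  m2∣ : + 2 ∣ a₀ → + (m ℕ.* 2) ∣ a₀ * + m
  m2∣ d = subst₂ _∣_ (trans (sym (pos-* 2 m)) (cong +_ (ℕ.*-comm 2 m))) refl (*-pres-∣ d (∣-refl {+ m}))

product-replicate : ∀ q k → product (replicate k q) ≡ q ℕ.^ k
product-replicate q zero    = refl
product-replicate q (suc k) = cong (q ℕ.*_) (product-replicate q k)

≋-replicate : ∀ {y} → All (λ x → x ≡ y [mod N ]) zs → zs ≋ replicate (length zs) y [mod N ]
≋-replicate []       = []
≋-replicate (e ∷ es) = e ∷ ≋-replicate es

≋-refl : ∀ xs → xs ≋ xs [mod N ]
≋-refl xs = Pointwise.refl λ {x} → ∣-resp (lemma x) ∣0
  where
  lemma : ∀ x → 0ℤ ≡ x - x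
  lemma = solve-∀

-- The Gao constant and its extremal sequences

module Extremal (R p : ℕ) (p-prime : Prime p) (p≢2 : p ≢ 2) where
  open Classification R p p-prime p≢2 public

  suc-n∸1 : suc (n ∸ 1) ≡ n
  suc-n∸1 = ℕ.m+[n∸m]≡n (ℕ.≤-trans (s≤s z≤n) 4≤n)

  half : n ℕ./ 2 ≡ h
  half = trans (cong (ℕ._/ 2) (trans (ℕ.*-assoc 2 (2 ℕ.^ R) p) (ℕ.*-comm 2 h))) (ℕ.m*n/n≡m h 2)

  n≡2*h : n ≡ 2 ℕ.* h
  n≡2*h = ℕ.*-assoc 2 (2 ℕ.^ R) p

  h∣n : + h ∣ + n
  h∣n = ∣ℕ⇒∣ (ℕ.divides 2 n≡2*h)

  2^r∣n : + (2 ℕ.^ r) ∣ + n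
  2^r∣n = ∣ℕ⇒∣ (ℕ.∣m⇒∣m*n p ℕ.∣-refl)

  p∣n : + p ∣ + n
  p∣n = ∣ℕ⇒∣ (ℕ.∣n⇒∣m*n (2 ℕ.^ r) ℕ.∣-refl)

  U-odd : ∀ {a} → U n a → OddInteger a
  U-odd {a} = U⇒odd (∣ℕ⇒∣ 2∣n) {a}

  p∤2^ : ∀ k → ¬ + p ∣ + (2 ℕ.^ k)
  p∤2^ k d = ¬prime[1] (subst Prime (ℕ.∣1⇒≡1 (go k (∣⇒∣ᵤ d))) p-prime)
    where
    p∤2 : ¬ p ℕ.∣ 2
    p∤2 p∣2 = p≢2 (ℕ.≤-antisym (ℕ.∣⇒≤ p∣2) (ℕ.nonTrivial⇒n>1 p {{prime⇒nonTrivial p-prime}}))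
    go : ∀ k → p ℕ.∣ 2 ℕ.^ k → p ℕ.∣ 1
    go zero d = d
    go (suc k) d = go k (ℕ.coprime-divisor (ℕ.sym (prime∤⇒coprime p-prime p∤2)) d)

  half-low : Low R (+ h)
  half-low = 2^R∣h , λ d → p-odd (∣*-cancel (2 ℕ.^ R) {{ℕ.m^n≢0 2 R}} 2 (+ p)
    (subst₂ _∣_ (cong +_ (ℕ.*-comm 2 (2 ℕ.^ R))) (pos-* (2 ℕ.^ R) p) d))

  2^R-low : Low R (+ (2 ℕ.^ R))
  2^R-low = ∣-refl , λ d → ℕ.<⇒≱ (ℕ.m<m*n (2 ℕ.^ R) 2 {{ℕ.m^n≢0 2 R}} (s≤s (s≤s z≤n)))
    (subst (ℕ._≤ 2 ℕ.^ R) (ℕ.*-comm 2 (2 ℕ.^ R)) (ℕ.∣⇒≤ {{ℕ.m^n≢0 2 R}} (∣⇒∣ᵤ d)))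

  -- Complements `Comb-parity`: if the sum vanishes modulo 2^r, so does k · 2^(r-1).
  even-count : ∀ {s} k → + (2 ℕ.^ r) ∣ s → + (2 ℕ.^ r) ∣ s - + k * + (2 ℕ.^ R) → 2 ℕ.∣ k
  even-count {s} k d e = ∣⇒∣ᵤ (∣*-cancel (2 ℕ.^ R) {{ℕ.m^n≢0 2 R}} 2 (+ k)
    (subst (λ z → + z ∣ + (2 ℕ.^ R) * + k) (ℕ.*-comm 2 (2 ℕ.^ R))
      (∣-resp (lemma s (+ k) (+ (2 ℕ.^ R))) (∣m∣n⇒∣m-n d e))))
    where
    lemma : ∀ s k t → s - (s - k * t) ≡ t * k
    lemma = solve-∀

  -- `Chain-skip` with M = n leaves only the n - 1 zeros, one too few.
  no-zero-sum-⋆ : ∀ ps b → All Prime ps → n ≡ product ps → (∀ i → Coprime (b i) (+ lookup ps i)) →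
                  ¬ Z (chain ps b ++ replicate (n ∸ 1) 0ℤ)
  no-zero-sum-⋆ ps b primes prod cop (s , w , d) = ℕ.<⇒≱ (ℕ.≤-reflexive suc-n∸1)
    (subst (n ≤_) (length-replicate (n ∸ 1)) (WSum-≤ (Chain-skip {1} {ps} {N = n}
      (trans (ℕ.*-identityˡ (product ps)) (sym prod))
      (subst (Chain 1 ps) (scaledChain-1 ps b) (scaledChain-Chain 1 ps b primes cop))
      ∣-refl (All.replicate⁺ (n ∸ 1) ∣0) w d)))

  -- `Chain-skip` with M = n/2 leaves exactly n entries, so all of them take part; m of them are odd
  -- multiples of 2^(r-1), and m would have to be even.
  no-zero-sum-∗ : ∀ ps b m → All Prime ps → n ≡ 2 ℕ.* product ps → (∀ i → Coprime (b i) (+ lookup ps i)) →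
                  OddInteger (+ m) → m ≤ n →
                  ¬ Z (chain ps b ++ replicate m (+ (n ℕ./ 2)) ++ replicate (n ∸ m) 0ℤ)
  no-zero-sum-∗ ps b m primes prod cop m-odd m≤n rewrite half = λ { (s , w , d) →
    m-odd (∣ℕ⇒∣ (even-count m (∣-trans 2^r∣n d) (Comb-parity U-odd
      (All.++⁺ (All.replicate⁺ m 2^R∣h) (All.replicate⁺ (n ∸ m) ∣0))
      (subst (λ k → Missing (2 ℕ.^ r) k (replicate m (+ h) ++ replicate (n ∸ m) 0ℤ))
        (trans (ℕ.+-identityʳ _) (length-replicate m))
        (Missing-++ (Missing-all (All.replicate⁺ m (proj₂ half-low))) (Missing-none (All.replicate⁺ (n ∸ m) ∣0))))
      (WSum-full (trans (length-++ (replicate m (+ h))) (trans (cong₂ ℕ._+_ (length-replicate m) (length-replicate (n ∸ m))) (ℕ.m+[n∸m]≡n m≤n)))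
        (Chain-skip {1} {ps} {N = n}
          (trans (ℕ.*-identityˡ (product ps)) (ℕ.*-cancelˡ-≡ (product ps) h 2 (trans (sym prod) n≡2*h)))
          (subst (Chain 1 ps) (scaledChain-1 ps b) (scaledChain-Chain 1 ps b primes cop))
          h∣n (All.++⁺ (All.replicate⁺ m ∣-refl) (All.replicate⁺ (n ∸ m) ∣0)) w (∣-trans h∣n d)))))) }

  -- `Chain-skip` with M = 2^(r-1) leaves n + 1 entries, of which one is omitted. Omitting c fails
  -- modulo p, keeping c fails modulo 2^r.
  no-zero-sum-∗∗ : ∀ a c → (∀ i → OddInteger (a i)) → + (2 ℕ.^ r) ∣ c →
                   ¬ Z (tabulate (λ (i : Fin R) → + (2 ℕ.^ toℕ i) * a i)
                          ++ c ∷ + (2 ℕ.^ R) ∷ replicate (n ∸ 1) (+ (n ℕ./ 2)))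
  no-zero-sum-∗∗ a c odd 2^r∣c rewrite half = λ { (s , w , d) → go n refl (Chain-skip {1} {replicate R 2} {N = n}
        (trans (ℕ.*-identityˡ _) (product-replicate 2 R))
        (subst (Chain 1 (replicate R 2)) (powers-1 R a) (powers-Chain 1 R a odd))
        (∣-trans 2^R∣h h∣n)
        (∣-trans 2^R∣2^r 2^r∣c ∷ ∣-refl ∷ All.replicate⁺ (n ∸ 1) 2^R∣h) w
        (∣-trans 2^R∣h (∣-trans h∣n d))) d }
    where
    2^R∣2^r : + (2 ℕ.^ R) ∣ + (2 ℕ.^ r)
    2^R∣2^r = ∣ℕ⇒∣ (ℕ.∣n⇒∣m*n 2 ℕ.∣-refl)
    -- Beside c there are n - 1 chosen entries, an odd number, all of them odd multiples of 2^(r-1).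
    odd-many : ∀ {k s} → suc k ≡ n → ∃[ ys ] All (Low R) ys × length ys ≡ k × Comb (U n) ys s → ¬ + (2 ℕ.^ r) ∣ s
    odd-many eq (ys , lows , refl , us) d = 2∣⇒¬2∣suc
      (even-count (length ys) d (Comb-parity U-odd (All.map proj₁ lows) (Missing-all (All.map proj₂ lows)) us))
      (subst (2 ℕ.∣_) (sym eq) 2∣n)
    -- Only the entry 2^(r-1) is prime to p, so the sum cannot vanish modulo p.
    first : ∀ {s} → Comb (U n) (+ (2 ℕ.^ R) ∷ replicate (n ∸ 1) (+ h)) s → ¬ + n ∣ s
    first (_∷_ {a = a} u us) d = p∤2^ R (U-cancel u p∣n (∣m+n∣n⇒∣m {m = a * + (2 ℕ.^ R)} (∣-trans p∣n d)
      (Comb-∣ (All.replicate⁺ (n ∸ 1) (∣ℕ⇒∣ (ℕ.∣n⇒∣m*n (2 ℕ.^ R) ℕ.∣-refl))) us)))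
    go : ∀ {s} k → k ≡ n → WSum (U n) k s (c ∷ + (2 ℕ.^ R) ∷ replicate (n ∸ 1) (+ h)) → ¬ + n ∣ s
    go k eq (skip w) = first (WSum-full (trans (trans (cong suc (length-replicate (n ∸ 1))) suc-n∸1) (sym eq)) w)
    go (suc k) eq (pick {a = a} u w) d = odd-many eq
      (WSum⇒Comb (2^R-low ∷ All.replicate⁺ (n ∸ 1) half-low) w)
      (∣m+n∣m⇒∣n {m = a * c} (∣-trans 2^r∣n d) (∣n⇒∣m*n a 2^r∣c))

  1≤n : 1 ≤ n
  1≤n = ℕ.≤-trans (s≤s z≤n) 4≤n

  length-⋆ : ∀ ps b → length ps ≡ suc r → length (chain ps b ++ replicate (n ∸ 1) 0ℤ) ≡ r ℕ.+ n
  length-⋆ ps b len = trans (length-++ (chain ps b)) (trans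
    (cong₂ ℕ._+_ (trans (length-tabulate _) len) (length-replicate (n ∸ 1)))
    (trans (sym (ℕ.+-suc r (n ∸ 1))) (cong (r ℕ.+_) suc-n∸1)))

  -- The lower bound comes from the sequence of form (⋆) with the primes p, 2, ..., 2 and all b
  -- equal to 1.
  gao : IsGaoConstant (U n) n (suc (r ℕ.+ n))
  gao = (s≤s z≤n , λ S len → ZeroSum⇒HasWeightedZeroSum {xs = S} 1≤n
          (upper r 0 refl (All.tabulate λ _ → 1∣) len)) , minimal
    where
    qs : List ℕ
    qs = p ∷ replicate r 2
    S₀ : List ℤ
    S₀ = chain qs (λ _ → 1ℤ) ++ replicate (n ∸ 1) 0ℤ
    bad : ¬ Z S₀
    bad = no-zero-sum-⋆ qs (λ _ → 1ℤ) (p-prime ∷ All.replicate⁺ r prime[2])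
      (trans (ℕ.*-comm (2 ℕ.^ r) p) (cong (p ℕ.*_) (sym (product-replicate 2 r))))
      (λ i → ℕ.1-coprimeTo (lookup qs i))
    minimal : ∀ j → GaoProperty (U n) n j → suc (r ℕ.+ n) ≤ j
    -- A smaller j is at most the length r + n of the example, whose prefix of length j would have a
    -- zero sum, and then so would the example.
    minimal j (_ , every) = ℕ.≮⇒≥ λ j<  → bad (ZeroSum-⊑ (⊑.take-⊆ j S₀) (HasWeightedZeroSum⇒ZeroSum {xs = take j S₀}
      (every (take j S₀) (trans (length-take j S₀) (ℕ.m≤n⇒m⊓n≡m
        (subst (j ≤_) (sym (length-⋆ qs (λ _ → 1ℤ) (cong suc (length-replicate r)))) (ℕ.s≤s⁻¹ j<)))))))

  gao-unique : ∀ {k} → IsGaoConstant (U n) n k → k ≡ suc (r ℕ.+ n)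
  gao-unique (prop , least) = ℕ.≤-antisym (least _ (proj₁ gao)) (proj₂ gao _ prop)

  extremal : ∀ {S} L → Equivalent (U n) n S L → length L ≡ r ℕ.+ n → ¬ Z L → GaoExtremal (U n) n S
  extremal {S} L e@(_ , _ , σ , _) len bad = suc (r ℕ.+ n) , gao , trans (↔⇒≡ σ) len ,
    λ z → bad (HasWeightedZeroSum⇒ZeroSum {xs = L} (HasWeightedZeroSum-Equivalent {S = S} {T = L} e 1≤n z))

  listed⇒extremal : ∀ {S T} → Equivalent (U n) n S T → HasListedForm n r T → GaoExtremal (U n) n S
  listed⇒extremal {S} {T} e (inj₁ (ps , b , len , primes , prod , cop , T≋)) = extremal {S} T e
    (trans (Pointwise.Pointwise-length T≋) (length-⋆ ps b len))
    (no-zero-sum-⋆ ps b primes prod cop ∘ ZeroSum-≋ T≋)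
  listed⇒extremal {S} {T} e (inj₂ (inj₁ (ps , b , m , len , primes , prod , cop , m-odd , _ , m≤n , T≋))) = extremal {S} T e
    (trans (Pointwise.Pointwise-length T≋) (trans (length-++ (chain ps b)) (cong₂ ℕ._+_ (trans (length-tabulate _) len)
      (trans (length-++ (replicate m (+ (n ℕ./ 2)))) (trans (cong₂ ℕ._+_ (length-replicate m) (length-replicate (n ∸ m))) (ℕ.m+[n∸m]≡n m≤n))))))
    (no-zero-sum-∗ ps b m primes prod cop m-odd m≤n ∘ ZeroSum-≋ T≋)
  listed⇒extremal {S} {T} e (inj₂ (inj₂ (a , c , odd , 2^r∣c , T≋))) = extremal {S} T e
    (trans (Pointwise.Pointwise-length T≋) (trans (length-++ (tabulate {n = R} (λ i → + (2 ℕ.^ toℕ i) * a i)))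
      (trans (cong₂ ℕ._+_ (length-tabulate {n = R} (λ i → + (2 ℕ.^ toℕ i) * a i)) (cong (λ z → suc (suc z)) (length-replicate (n ∸ 1))))
        (trans (ℕ.+-suc R (suc (n ∸ 1))) (cong (suc R ℕ.+_) suc-n∸1)))))
    (no-zero-sum-∗∗ a c odd 2^r∣c ∘ ZeroSum-≋ T≋)

  -- In y = w · 2^(r-1) the factor w is odd and prime to p, hence a unit modulo n.
  low-associated : ∀ {y} → Low R y → ¬ + p ∣ y → Associated n y (+ (2 ℕ.^ R))
  low-associated {y} (divides w refl , 2∤) p∤y = proj₁ w-unit , U-inverse {a = w} w-unit ,
    ∣-resp (lemma w (proj₁ w-unit) (+ (2 ℕ.^ R))) (∣n⇒∣m*n (- + (2 ℕ.^ R)) (proj₁ (proj₂ w-unit)))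
    where
    open Split (split r) using (S; T; S+T)
    lemma : ∀ w w′ t → - t * (w′ * w - 1ℤ) ≡ t - w′ * (w * t)
    lemma = solve-∀
    lemma′ : ∀ w S T → w * T + w * S ≡ w * (S + T)
    lemma′ = solve-∀
    w-unit : U n w
    -- `U-crt` applied to w on both sides gives the unit wT + wS, which is w.
    w-unit = subst (U n) (trans (lemma′ w S T) (trans (cong (w *_) S+T) (*-identityʳ w)))
      (U-crt (split r) {w} {w} (prime∤⇒U p-prime λ d → p∤y (∣m⇒∣m*n (+ (2 ℕ.^ R)) d)) (odd⇒U2^ r (odd-quotient w 2∤)))

  outcome⇒listed : ∀ {S} → Outcome 1 r S → ∃[ T ] Equivalent (U n) n S T × HasListedForm n r T
  outcome⇒listed {S} (inj₁ o) = _ , ↭-Equivalent n {S} perm , inj₁ (factors , proj₁ b , length-factors , primes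
      , trans (sym product-factors) (ℕ.*-identityˡ (product factors)) , proj₁ (proj₂ b)
      , Pointwise.++⁺ (subst (links ≋_[mod n ]) (trans (proj₂ (proj₂ b)) (scaledChain-1 factors (proj₁ b))) (≋-refl links))
          (subst (λ k → Y ≋ replicate k 0ℤ [mod n ]) (cong (_∸ 1) length-Y) (≋-replicate zeros)))
    where
    open Outcome⋆ o
    b = Chain-scaledChain primes chained
  outcome⇒listed {S} (inj₂ (inj₁ o)) = _ , ↭-Equivalent n {S} perm , inj₂ (inj₁ (factors , proj₁ b , length Y₁ , length-factors , primes
      , trans n≡2*h (cong (2 ℕ.*_) (trans (sym product-factors) (ℕ.*-identityˡ (product factors)))) , proj₁ (proj₂ b)
      , (λ d → odd (∣⇒∣ᵤ d)) , 1≤ (length Y₁) odd , subst (length Y₁ ≤_) length-Y (ℕ.m≤m+n _ _)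
      , Pointwise.++⁺ (subst (links ≋_[mod n ]) (trans (proj₂ (proj₂ b)) (scaledChain-1 factors (proj₁ b))) (≋-refl links))
          (Pointwise.++⁺ (subst (λ z → Y₁ ≋ replicate (length Y₁) (+ z) [mod n ]) (sym half) (≋-replicate halves))
            (subst (λ k → Y₀ ≋ replicate k 0ℤ [mod n ])
              (trans (sym (ℕ.m+n∸m≡n (length Y₁) (length Y₀))) (cong (_∸ length Y₁) length-Y)) (≋-replicate zeros)))))
    where
    open Outcome∗ o
    b = Chain-scaledChain primes chained
    1≤ : ∀ m → ¬ 2 ℕ.∣ m → 1 ≤ m
    1≤ zero    odd = ⊥-elim (odd (ℕ.divides 0 refl))
    1≤ (suc m) odd = s≤s z≤n
  -- Matching on the equation for `j′` fixes the number of links at r - 1, as (∗∗) demands.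
  outcome⇒listed {S} (inj₂ (inj₂ o)) with Outcome∗∗.j′ o | Outcome∗∗.suc-j′ o | Outcome∗∗.chained o
  ... | k | refl | chained = _ , ↭-Equivalent-replace n links c perm (low-associated low p∤y)
      , inj₂ (inj₂ (proj₁ α , c , proj₁ (proj₂ α) , 2^r∣c
      , Pointwise.++⁺ (subst (links ≋_[mod n ]) (trans (proj₂ (proj₂ α)) (powers-1 R (proj₁ α))) (≋-refl links))
          (Pointwise.++⁺ (≋-refl (c ∷ + (2 ℕ.^ R) ∷ []))
            (subst₂ (λ k z → Y ≋ replicate k (+ z) [mod n ]) (cong (_∸ 1) length-Y) (sym half) (≋-replicate halves)))))
    where
    open Outcome∗∗ o using (links; c; perm; low; p∤y; 2^r∣c; Y; halves; length-Y)
    α = Chain-powers R chained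

  extremal⇒listed : ∀ {S} → GaoExtremal (U n) n S → ∃[ T ] Equivalent (U n) n S T × HasListedForm n r T
  extremal⇒listed {S} (k , isGao , len , bad) = outcome⇒listed {S} (classify r 0 refl (All.tabulate λ _ → 1∣)
    (trans len (cong (_∸ 1) (gao-unique isGao))) (bad ∘ ZeroSum⇒HasWeightedZeroSum {xs = S} 1≤n))

theorem6 : ∀ (n r p : ℕ) → Prime p → p ≢ 2 → 2 ≤ r → n ≡ 2 ℕ.^ r ℕ.* p →
    ∀ (S : Sequence) → ExactlyOneOddTerm n S →
    GaoExtremal (U n) n S ⇔ (∃[ T ] Equivalent (U n) n S T × HasListedForm n r T)
theorem6 _ (suc R) p p-prime p≢2 _ refl S _ =
  mk⇔ (extremal⇒listed {S}) (λ { (T , e , listed) → listed⇒extremal {S} {T} e listed })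
  where open Extremal R p p-prime p≢2
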